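{- For every finite alphabet $\Sigma$ and every context-free language $L \subseteq \Sigma^+$ there exist a finite alphabet $\Omega$, a homomorphism $h \colon \Sigma \to \Omega^+$ (extended to strings by $h(a_1 \ldots a_n)=h(a_1)\ldots h(a_n)$), and a categorial grammar $G=(\Omega, \mathrm{BC}, \triangleright, S)$ with unique category assignment, such that for every string $w \in \Sigma^+$, $w$ is in $L$ if and only if $h(w)$ is in $L(G)$.
   Context: All languages are assumed to be without the empty string: $\Sigma^+$ is the set of non-empty strings over $\Sigma$, and a language over $\Sigma$ is a subset of $\Sigma^+$. Let $\mathrm{BC}$ be a finite set of primitive categories. The set of categories is defined inductively: every primitive category is a category; if $A$ and $B$ are categories, then so are $(B \backslash A)$ and $(A / B)$. Strings of categories are written with semicolons between individual categories. A categorial grammar is a quadruple $(\Sigma, \mathrm{BC}, \triangleright, S)$, where $\Sigma$ is a finite alphabet, $\mathrm{BC}$ is a finite set of primitive categories, $\triangleright$ is a finite relation of category assignments of the form $a \triangleright A$ with $a \in \Sigma$ and $A$ a category, and $S$ is a category (not necessarily primitive) designated as the target category. A string of categories $\alpha$ is reducible in one step to a string of categories $\beta$ if $\alpha=\eta; A/B; B; \theta$ or $\alpha=\eta; B; B \backslash A; \theta$, while $\beta=\eta; A; \theta$, for some categories $A, B$ and some (possibly empty) strings of categories $\eta,\theta$. A string $\alpha$ is reducible to $\beta$ if it can be transformed to $\beta$ by zero or more such steps. The language defined by $G=(\Sigma, \mathrm{BC}, \triangleright, S)$ is the set $L(G)$ of all strings $a_1 \ldots a_n$ ($n \geqslant 1$,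 $a_i \in \Sigma$) for which there exists a string of categories $A_1; \ldots; A_n$ with $a_i \triangleright A_i$ for all $i$ that is reducible to $S$. A categorial grammar is with unique category assignment if for every symbol $a$ of its alphabet there is a unique category $A$ with $a \triangleright A$. -}

module Defs where

open import Data.Fin.Base using (Fin)
open import Data.List.Base using (List; []; _∷_; _++_; [_]; map)
open import Data.List.Membership.Propositional using (_∈_)
open import Data.List.NonEmpty.Base using (List⁺; toList)
open import Data.List.Relation.Binary.Pointwise.Base using (Pointwise)
open import Data.Product using (∃!; ∃-syntax; _×_; _,_)
open import Data.Sum.Base using (_⊎_; inj₁; inj₂)
open import Function.Bundles using (_↔_; _⇔_)
open import Level using (Level; 0ℓ; _⊔_) renaming (suc to lsuc)
open import Relation.Binary.Construct.Closure.ReflexiveTransitive using (Star)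
open import Relation.Binary.PropositionalEquality using (_≡_)
open import Relation.Nullary using (¬_)
open import Relation.Unary using (Pred)

Finite : Set → Set
Finite A = ∃[ n ] (A ↔ Fin n)

Language : Set → (ℓ : Level) → Set (lsuc ℓ)
Language Σ ℓ = Pred (List⁺ Σ) ℓ

-- Right-hand sides of rules are arbitrary; in particular they may be empty.
record ContextFreeGrammar (Σ : Set) : Set₁ where
  field
    N       : Set
    finiteN : Finite N
    rules   : List (N × List (N ⊎ Σ))
    start   : N

  SententialForm : Set
  SententialForm = List (N ⊎ Σ)

  data _⇒_ : SententialForm → SententialForm → Set where
    rewriteAt : ∀ (η θ : SententialForm) {A α} → (A , α) ∈ rules →
                (η ++ inj₁ A ∷ θ) ⇒ (η ++ α ++ θ)

  _⇒*_ : SententialForm → SententialForm → Set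
  _⇒*_ = Star _⇒_

  Generates : List Σ → Set
  Generates w = [ inj₁ start ] ⇒* map inj₂ w

-- A grammar generates a subset of Σ*; for it to equal L ⊆ Σ⁺, it must not
-- generate the empty string.
ContextFree : ∀ {Σ : Set} {ℓ} → Language Σ ℓ → Set (lsuc 0ℓ ⊔ ℓ)
ContextFree {Σ} L =
  ∃[ G ] let open ContextFreeGrammar {Σ} G in
    ¬ Generates [] × (∀ w → L w ⇔ Generates (toList w))

infixr 6 _\\_
infixl 6 _/_

data Category (BC : Set) : Set where
  prim : BC → Category BC
  _\\_ : (B A : Category BC) → Category BC
  _/_  : (A B : Category BC) → Category BC

module _ {BC : Set} where

  data _⟶_ : List (Category BC) → List (Category BC) → Set where
    reduce/  : ∀ η θ A B → (η ++ A / B ∷ B ∷ θ) ⟶ (η ++ A ∷ θ)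
    reduce\\ : ∀ η θ A B → (η ++ B ∷ B \\ A ∷ θ) ⟶ (η ++ A ∷ θ)

  _⟶*_ : List (Category BC) → List (Category BC) → Set
  _⟶*_ = Star _⟶_

record CategorialGrammar (Ω : Set) : Set₁ where
  field
    BC          : Set
    finiteBC    : Finite BC
    assignments : List (Ω × Category BC)
    target      : Category BC

  _▷_ : Ω → Category BC → Set
  a ▷ A = (a , A) ∈ assignments

  language : Language Ω 0ℓ
  language w = ∃[ As ] (Pointwise _▷_ (toList w) As × As ⟶* [ target ])

  UniqueAssignment : Set
  UniqueAssignment = ∀ a → ∃! _≡_ (a ▷_)

{-# OPTIONS --safe #-}
module Submission where

-- A stack machine runs through a fixed sequence of instructions: push a word, pop a symbol, or
-- optionally pop a symbol.  Each instruction is a short string of categories.  With e = y \ y and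
-- E b = b \ b, pushing b₁ … bₙ is the category e / E bₙ / e / … / E b₁ / e, popping b is E b, and the
-- optional pop is e / b ; b ; E b, which reduces either to e or to e ; E b; the string e / y ; y
-- starts a chain that absorbs every following e.  Reducibility then means that a run exists.
--
-- It remains to find instruction sequences h a such that the runs of h a₁ … h aₙ simulate leftmost
-- derivations of a grammar whose rules have the form A → a B₁ … Bₘ.  For every rule of the letter
-- a, h a has a block that either does nothing or replaces A by B₁ … Bₘ on the stack.  Guard symbols
-- ensure that a block used in any other way leaves an irremovable pair of neighbours on the stack.
-- This works provided that Bₘ has a smaller rank than A, which rules out right recursion.  Such a
-- grammar is obtained by binarising, cutting the trees along their left spines (which makes every
-- rule start with a letter), and then cutting them along their right spines.

open import Defs
open import Data.Empty using (⊥-elim)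
open import Data.Fin.Base using (Fin)
open import Data.Fin.Patterns using (0F; 1F; 2F)
open import Data.Fin.Properties using (any?; +↔⊎; *↔×)
import Data.Fin.Properties as Fin
open import Data.List.Base using
  (List; []; _∷_; _++_; [_]; map; filter; length; lookup; allFin; _∷ʳ_; initLast; _∷ʳ′_)
import Data.List.Base as List
import Data.List.Membership.DecPropositional as DecMembership
open import Data.List.Membership.Propositional using (_∈_; find; lose)
open import Data.List.Membership.Propositional.Properties using
  (∈-map⁺; ∈-map⁻; ∈-++⁺ˡ; ∈-++⁺ʳ; ∈-++⁻; ∈-concatMap⁺; ∈-concatMap⁻; ∈-filter⁺; ∈-filter⁻;
   ∈-allFin; ∈-lookup)
open import Data.List.NonEmpty.Base using (List⁺; _∷_; toList; concatMap)
open import Data.List.NonEmpty.Properties using (toList->>=)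
open import Data.List.Properties using
  (++-assoc; ++-identityʳ; length-++; map-++; ≡-dec; ∷ʳ-injective; concatMap-cong; concatMap-++;
   map-concatMap)
open import Data.List.Relation.Binary.Pointwise.Base using (Pointwise; []; _∷_)
open import Data.List.Relation.Unary.All using (All; []; _∷_; all?)
import Data.List.Relation.Unary.All as All
open import Data.List.Relation.Unary.All.Properties using (++⁺)
open import Data.List.Relation.Unary.Any using (here; there; index)
open import Data.List.Relation.Unary.Any.Properties using (lookup-index)
open import Data.Maybe.Base using (Maybe; just; nothing)
open import Data.Nat.Base using (ℕ; zero; suc; _+_; _<_; _≤_; z≤n; s≤s)
open import Data.Nat.Properties using
  (suc-injective; <⇒≱; <⇒≤; ≤-trans; ≤-refl; ≤-reflexive; m≤m+n; m≤n+m; n≤1+n)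
open import Data.Product using (∃; ∃-syntax; _×_; _,_; proj₁; proj₂)
open import Data.Product.Function.NonDependent.Propositional using (_×-↔_)
open import Data.Sum.Base using (_⊎_; inj₁; inj₂; [_,_]′)
open import Data.Sum.Function.Propositional using (_⊎-↔_)
import Data.Sum.Properties as Sum
open import Data.Unit.Base using (⊤; tt)
open import Function.Base using (_∘_; id)
open import Function.Bundles using (_↔_; _⇔_; Inverse; Equivalence; mk↔ₛ′; mk⇔)
open import Function.Construct.Composition using (_↔-∘_)
open import Function.Construct.Symmetry using (↔-sym)
open import Function.Properties.Inverse using (↔⇒↣)
open import Relation.Binary.Construct.Closure.ReflexiveTransitive using (ε; _◅_; _◅◅_; gmap)
open import Relation.Binary.Definitions using (DecidableEquality)
open import Relation.Binary.PropositionalEquality using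
  (_≡_; _≢_; refl; sym; trans; cong; cong₂; subst)
open import Relation.Nullary using (¬_; Dec; yes; no)
open import Relation.Nullary.Decidable using (via-injection; map′; _×-dec_)
open import Relation.Unary using (Decidable)

-- Stack machines as strings of categories

data Op (Sym : Set) : Set where
  push : List Sym → Op Sym
  opt  : Sym → Op Sym
  pop  : Sym → Op Sym

module Machine {Sym : Set} where

  data OpStep : Op Sym → List Sym → List Sym → Set where
    push : ∀ {π s} → OpStep (push π) s (π ++ s)
    skip : ∀ {b s} → OpStep (opt b) s s
    take : ∀ {b s} → OpStep (opt b) (b ∷ s) s
    pop  : ∀ {b s} → OpStep (pop b) (b ∷ s) s

  data Run : List (Op Sym) → List Sym → List Sym → Set where
    []  : ∀ {s} → Run [] s s
    _∷_ : ∀ {o os s t u} → OpStep o s t → Run os t u → Run (o ∷ os) s u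

  run-++⁺ : ∀ {os ps s t u} → Run os s t → Run ps t u → Run (os ++ ps) s u
  run-++⁺ []       q = q
  run-++⁺ (x ∷ p)  q = x ∷ run-++⁺ p q

  run-++⁻ : ∀ os {ps s u} → Run (os ++ ps) s u → ∃[ t ] Run os s t × Run ps t u
  run-++⁻ []       q       = _ , [] , q
  run-++⁻ (o ∷ os) (x ∷ r) with t , p , q ← run-++⁻ os r = t , x ∷ p , q

module Coding (Sym : Set) where
  open Machine {Sym}

  Cat : Set
  Cat = Category (Maybe Sym)

  pattern 𝕪 = prim nothing
  pattern 𝕖 = prim nothing \\ prim nothing
  pattern slot b = prim (just b)

  E : Sym → Cat
  E b = slot b \\ slot b

  -- Arguments are taken from the outside in, so the top of the stack is served first. The `𝕖`
  -- before each `E b` takes up whatever separates two pops.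
  pushCat : List Sym → Cat
  pushCat []      = 𝕖
  pushCat (b ∷ π) = pushCat π / E b / 𝕖

  P : List Cat
  P = 𝕖 / 𝕪 ∷ 𝕪 ∷ []

  code : Op Sym → List Cat
  code (push π) = pushCat π ∷ P
  code (opt b)  = 𝕖 / slot b ∷ slot b ∷ E b ∷ P
  code (pop b)  = E b ∷ P

  -- An irreducible string that stands for emptying the stack `u`. A push category takes its
  -- arguments from it pair by pair.
  W : List Sym → List Cat
  W []      = 𝕖 ∷ []
  W (b ∷ u) = 𝕖 ∷ E b ∷ W u

  ∷-step : ∀ A {α β : List Cat} → α ⟶ β → (A ∷ α) ⟶ (A ∷ β)
  ∷-step A (reduce/  η θ B C) = reduce/  (A ∷ η) θ B C
  ∷-step A (reduce\\ η θ B C) = reduce\\ (A ∷ η) θ B C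

  ∷-cong : ∀ A {α β} → α ⟶* β → (A ∷ α) ⟶* (A ∷ β)
  ∷-cong A = gmap (A ∷_) (∷-step A)

  ++-cong : ∀ η {α β} → α ⟶* β → (η ++ α) ⟶* (η ++ β)
  ++-cong []      r = r
  ++-cong (A ∷ η) r = ∷-cong A (++-cong η r)

  close-P : ∀ r → (P ++ r) ⟶* (𝕖 ∷ r)
  close-P r = reduce/ [] r 𝕖 𝕪 ◅ ε

  absorb : ∀ r → (P ++ 𝕖 ∷ r) ⟶* (P ++ r)
  absorb r = reduce\\ (𝕖 / 𝕪 ∷ []) r 𝕪 𝕪 ◅ ε

  absorb-W : ∀ u → (P ++ W u) ⟶* W u
  absorb-W []      = absorb [] ◅◅ close-P []
  absorb-W (b ∷ u) = absorb (E b ∷ W u) ◅◅ close-P (E b ∷ W u)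

  feed : ∀ π ρ u → (pushCat (π ++ ρ) ∷ W (π ++ u)) ⟶* (pushCat ρ ∷ W u)
  feed []      ρ u = ε
  feed (b ∷ π) ρ u =
    reduce/ [] (E b ∷ W (π ++ u)) (pushCat (π ++ ρ) / E b) 𝕖 ◅
    reduce/ [] (W (π ++ u)) (pushCat (π ++ ρ)) (E b) ◅
    feed π ρ u

  codes : List (Op Sym) → List Cat
  codes = List.concatMap code

  -- Induction from the end of the run: the later operations are already reduced to the pops of the
  -- current stack. A push cancels against the first of these, and the leading `P` swallows the `𝕖`
  -- that remains.
  run⇒reduces : ∀ {os u} → Run os u [] → (P ++ codes os) ⟶* W u
  run⇒reduces [] = close-P []
  run⇒reduces {push π ∷ os} {u} (push ∷ r) =
    ++-cong P (∷-cong (pushCat π) (run⇒reduces r)) ◅◅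
    subst (λ ρ → (P ++ pushCat ρ ∷ W (π ++ u)) ⟶* (P ++ 𝕖 ∷ W u))
          (++-identityʳ π) (++-cong P (feed π [] u)) ◅◅
    absorb (W u) ◅◅ absorb-W u
  -- To skip, the slot absorbs `E b` before it is closed. To take, the slot closes at once and `E b`
  -- survives as a pop.
  run⇒reduces {opt b ∷ os} {u} (skip ∷ r) =
    reduce\\ (𝕖 / 𝕪 ∷ 𝕪 ∷ 𝕖 / slot b ∷ []) (P ++ codes os) (slot b) (slot b) ◅
    reduce/ P (P ++ codes os) 𝕖 (slot b) ◅
    (absorb (P ++ codes os) ◅◅ ++-cong P (run⇒reduces r) ◅◅ absorb-W u)
  run⇒reduces {opt b ∷ os} {_ ∷ u} (take ∷ r) =
    reduce/ P (E b ∷ P ++ codes os) 𝕖 (slot b) ◅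
    (absorb (E b ∷ P ++ codes os) ◅◅ close-P (E b ∷ P ++ codes os) ◅◅
     ++-cong (𝕖 ∷ E b ∷ []) (run⇒reduces r))
  run⇒reduces {pop b ∷ os} {_ ∷ u} (pop ∷ r) =
    close-P (E b ∷ P ++ codes os) ◅◅ ++-cong (𝕖 ∷ E b ∷ []) (run⇒reduces r)

  -- A push category whose last argument is still missing: the computation ends with `b` alone on
  -- the stack.
  target : Sym → Cat
  target b = 𝕖 / E b

  complete : ∀ π b {os} → Run os π [] → codes (push (π ++ [ b ]) ∷ os) ⟶* [ target b ]
  complete π b r =
    ∷-cong _ (run⇒reduces r) ◅◅
    subst (λ ρ → (pushCat (π ++ [ b ]) ∷ W ρ) ⟶* (pushCat [ b ] ∷ W []))
          (++-identityʳ π) (feed π [ b ] []) ◅◅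
    reduce/ [] [] (𝕖 / E b) 𝕖 ◅ ε

  -- Soundness of the coding: reductions read backwards as runs

  data PushCat : Cat → List Sym → Set where
    base  : PushCat 𝕖 []
    arg-𝕖 : ∀ {X π} → PushCat X π → PushCat (X / 𝕖) π
    arg-E : ∀ {X π b} → PushCat X π → PushCat (X / E b) (b ∷ π)

  -- An invariant of reduction: no other categories arise from codes. `PushCat` allows the arguments
  -- in any order, so it stays closed when an argument has been consumed.
  data Kind : Cat → Set where
    chain : Kind 𝕪
    slot′ : ∀ b → Kind (slot b)
    pop   : ∀ b → Kind (E b)
    open′ : ∀ x → Kind (𝕖 / prim x)
    push  : ∀ {X π} → PushCat X π → Kind X

  -- The mark records a letter b of an optional pop that goes on to absorb the following E b, which
  -- therefore must not pop.
  data Step : Cat → Maybe Sym → List Sym → Maybe Sym → List Sym → Set where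
    chain : ∀ {s} → Step 𝕪 nothing s nothing s
    idle  : ∀ {b s} → Step (slot b) nothing s nothing s
    mark  : ∀ {b s} → Step (slot b) nothing s (just b) s
    pop   : ∀ {b s} → Step (E b) nothing (b ∷ s) nothing s
    keep  : ∀ {b s} → Step (E b) (just b) s (just b) s
    drop  : ∀ {b s} → Step (E b) (just b) s nothing s
    open′ : ∀ {x s} → Step (𝕖 / prim x) nothing s nothing s
    push  : ∀ {X π s} → PushCat X π → Step X nothing s nothing (π ++ s)

  data Steps : List Cat → Maybe Sym → List Sym → Maybe Sym → List Sym → Set where
    []  : ∀ {m s} → Steps [] m s m s
    _∷_ : ∀ {X α m s m₁ s₁ m₂ s₂} → Step X m s m₁ s₁ → Steps α m₁ s₁ m₂ s₂ →
          Steps (X ∷ α) m s m₂ s₂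

  push-inv : ∀ {X ρ m s m′ s′} → PushCat X ρ → Step X m s m′ s′ →
             ∃[ π ] PushCat X π × m ≡ nothing × m′ ≡ nothing × s′ ≡ π ++ s
  push-inv base (push q) = _ , q , refl , refl , refl
  push-inv (arg-𝕖 p) (push q) = _ , q , refl , refl , refl
  push-inv (arg-E p) (push q) = _ , q , refl , refl , refl

  kind/ : ∀ {A B} → Kind (A / B) → Kind A
  kind/ (open′ x)        = push base
  kind/ (push (arg-𝕖 p)) = push p
  kind/ (push (arg-E p)) = push p

  kind\\ : ∀ {A B} → Kind (B \\ A) → Kind A
  kind\\ (pop b)     = slot′ b
  kind\\ (push base) = chain

  -- Every effect of the result of a reduction is also an effect of the two cancelled categories in
  -- succession: `X / E b` pushes one symbol more than `X`, and `E b` pops it again.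
  expand/ : ∀ {A B m s m′ s′} → Kind (A / B) → Step A m s m′ s′ →
            ∃ λ m₁ → ∃ λ s₁ → Step (A / B) m s m₁ s₁ × Step B m₁ s₁ m′ s′
  expand/ (open′ nothing)  (push base) = _ , _ , open′ , chain
  expand/ (open′ (just b)) (push base) = _ , _ , open′ , idle
  expand/ (push (arg-𝕖 p)) st with _ , q , refl , refl , refl ← push-inv p st =
    _ , _ , push (arg-𝕖 q) , push base
  expand/ (push (arg-E p)) st with _ , q , refl , refl , refl ← push-inv p st =
    _ , _ , push (arg-E q) , pop

  expand\\ : ∀ {A B m s m′ s′} → Kind (B \\ A) → Step A m s m′ s′ →
             ∃ λ m₁ → ∃ λ s₁ → Step B m s m₁ s₁ × Step (B \\ A) m₁ s₁ m′ s′
  expand\\ (pop b) idle        = _ , _ , mark , drop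
  expand\\ (pop b) mark        = _ , _ , mark , keep
  expand\\ (pop b) (push ())
  expand\\ (push base) chain   = _ , _ , chain , push base
  expand\\ (push base) (push ())

  kinds : ∀ {α β} → α ⟶ β → All Kind α → All Kind β
  kinds (reduce/  [] θ A B) (k ∷ _ ∷ ks) = kind/ k ∷ ks
  kinds (reduce\\ [] θ A B) (_ ∷ k ∷ ks) = kind\\ k ∷ ks
  kinds (reduce/  (X ∷ η) θ A B) (k ∷ ks) = k ∷ kinds (reduce/  η θ A B) ks
  kinds (reduce\\ (X ∷ η) θ A B) (k ∷ ks) = k ∷ kinds (reduce\\ η θ A B) ks

  unreduce : ∀ {α β m s m′ s′} → α ⟶ β → All Kind α → Steps β m s m′ s′ → Steps α m s m′ s′
  unreduce (reduce/  [] θ A B) (k ∷ _ ∷ ks) (x ∷ xs)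
    with _ , _ , y , z ← expand/ k x = y ∷ z ∷ xs
  unreduce (reduce\\ [] θ A B) (_ ∷ k ∷ ks) (x ∷ xs)
    with _ , _ , y , z ← expand\\ k x = y ∷ z ∷ xs
  unreduce (reduce/  (X ∷ η) θ A B) (k ∷ ks) (x ∷ xs) = x ∷ unreduce (reduce/  η θ A B) ks xs
  unreduce (reduce\\ (X ∷ η) θ A B) (k ∷ ks) (x ∷ xs) = x ∷ unreduce (reduce\\ η θ A B) ks xs

  unreduce* : ∀ {α β m s m′ s′} → α ⟶* β → All Kind α → Steps β m s m′ s′ → Steps α m s m′ s′
  unreduce* ε        ks xs = xs
  unreduce* (r ◅ rs) ks xs = unreduce r ks (unreduce* rs (kinds r ks) xs)

  pushCat-PushCat : ∀ π → PushCat (pushCat π) π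
  pushCat-PushCat []      = base
  pushCat-PushCat (b ∷ π) = arg-𝕖 (arg-E (pushCat-PushCat π))

  PushCat-unique : ∀ π {ρ} → PushCat (pushCat π) ρ → ρ ≡ π
  PushCat-unique []      base              = refl
  PushCat-unique (b ∷ π) (arg-𝕖 (arg-E p)) = cong (b ∷_) (PushCat-unique π p)

  kind-code : ∀ o → All Kind (code o)
  kind-code (push π) = push (pushCat-PushCat π) ∷ open′ nothing ∷ chain ∷ []
  kind-code (opt b)  = open′ (just b) ∷ slot′ b ∷ pop b ∷ open′ nothing ∷ chain ∷ []
  kind-code (pop b)  = pop b ∷ open′ nothing ∷ chain ∷ []

  kind-codes : ∀ os → All Kind (codes os)
  kind-codes []       = []
  kind-codes (o ∷ os) = ++⁺ (kind-code o) (kind-codes os)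

  -- Each code ends with `P`, which demands an empty mark. A mark set by a slot must therefore be
  -- dropped by the `E b` right after it, and an optional pop is left with its two proper outcomes.
  steps⇒run : ∀ os {s s′} → Steps (codes os) nothing s nothing s′ → Run os s s′
  steps⇒run [] [] = []
  steps⇒run (push π ∷ os) (x ∷ xs) with push-inv (pushCat-PushCat π) x
  steps⇒run (push π ∷ os) (x ∷ open′ ∷ chain ∷ xs) | _ , q , _ , refl , refl
    with refl ← PushCat-unique π q = push ∷ steps⇒run os xs
  steps⇒run (opt b ∷ os) (open′ ∷ idle ∷ pop ∷ open′ ∷ chain ∷ xs)  = take ∷ steps⇒run os xs
  steps⇒run (opt b ∷ os) (open′ ∷ mark ∷ drop ∷ open′ ∷ chain ∷ xs) = skip ∷ steps⇒run os xs
  steps⇒run (pop b ∷ os) (pop ∷ open′ ∷ chain ∷ xs) = pop ∷ steps⇒run os xs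

  -- The target itself pushes `b` onto the empty stack; this single step is pulled back through the
  -- reductions.
  sound : ∀ os b → codes os ⟶* [ target b ] → Run os [] [ b ]
  sound os b r = steps⇒run os (unreduce* r (kind-codes os) (push (arg-E base) ∷ []))

-- Simulating a grammar by a stack machine

module Generation {Σ I : Set} (R : Σ → I → List I → Set) where

  -- Leftmost derivations with the pending nonterminals as a stack. One rule is used per letter,
  -- which is what one `ops a` has to simulate.
  data Gen : List I → List Σ → Set where
    []  : Gen [] []
    _∷_ : ∀ {a i α s w} → R a i α → Gen (α ++ s) w → Gen (i ∷ s) (a ∷ w)

LastAll : {A : Set} → (A → Set) → List A → Set
LastAll Q []          = ⊤
LastAll Q (x ∷ [])    = Q x
LastAll Q (_ ∷ y ∷ xs) = LastAll Q (y ∷ xs)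

data Sym (I : Set) : Set where
  nt guard        : I → Sym I
  hash dollar bot : Sym I

module Simulation {Σ I : Set} (rules : Σ → List (I × List I)) (rank : I → ℕ)
  (ranked : ∀ {a i α} → (i , α) ∈ rules a → LastAll (λ k → rank k < rank i) α) (S : I) where

  open Machine {Sym I}
  open Generation (λ a i α → (i , α) ∈ rules a)

  Stack : Set
  Stack = List (Sym I)

  -- A body is pushed with separators before its symbols. Popping its first `hash` and keeping the
  -- one below the replaced nonterminal gives separators after the symbols; for an empty body, that
  -- lower `hash` is the one popped. The `dollar` of `κ` certifies that a rule has been applied.
  pre enc : List I → Stack
  pre = List.concatMap (λ k → hash ∷ nt k ∷ [])
  enc = List.concatMap (λ k → nt k ∷ hash ∷ [])

  κ : List I → Stack
  κ α = dollar ∷ pre α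

  -- Two guards are pushed, and the final pop must remove one of them. It is the second if the body
  -- stays (after the first guard and `nt i` have been taken), and the first if the second guard and
  -- the body have been taken off again.
  block : I × List I → List (Op (Sym I))
  block (i , α) =
    push [ guard i ] ∷ opt (guard i) ∷ opt (nt i) ∷
    push (guard i ∷ κ α) ∷ opt (guard i) ∷ map opt (κ α) ++ pop (guard i) ∷ []

  blocks : List (I × List I) → List (Op (Sym I))
  blocks = List.concatMap block

  init : Stack
  init = bot ∷ nt S ∷ hash ∷ []

  body : Σ → List (Op (Sym I))
  body a = blocks (rules a) ++ pop dollar ∷ pop hash ∷ []

  -- Unless all three optional pops are taken or all are skipped, pop bot fails.  If they are skipped,
  -- the lower bot is never removed, which the final stack [ bot ] permits for the first letter only.
  rest : Σ → List (Op (Sym I))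
  rest a = opt bot ∷ opt (nt S) ∷ opt hash ∷ pop bot ∷ body a

  ops : Σ → List (Op (Sym I))
  ops a = push (init ++ [ bot ]) ∷ rest a

  -- Runs obtained from derivations

  pre-enc : ∀ α js s → pre α ++ hash ∷ enc js ++ s ≡ hash ∷ enc (α ++ js) ++ s
  pre-enc []      js s = refl
  pre-enc (k ∷ α) js s = cong (λ t → hash ∷ nt k ∷ t) (pre-enc α js s)

  skips : ∀ ρ {s} → Run (map opt ρ) s s
  skips []      = []
  skips (b ∷ ρ) = skip ∷ skips ρ

  takes : ∀ ρ {s} → Run (map opt ρ) (ρ ++ s) s
  takes []      = []
  takes (b ∷ ρ) = take ∷ takes ρ

  block-idle : ∀ r {s} → Run (block r) s s
  block-idle (i , α) = push ∷ skip ∷ skip ∷ push ∷ take ∷ run-++⁺ (takes (κ α)) (pop ∷ [])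

  block-apply : ∀ i α {s} → Run (block (i , α)) (nt i ∷ s) (κ α ++ s)
  block-apply i α = push ∷ take ∷ take ∷ push ∷ skip ∷ run-++⁺ (skips (κ α)) (pop ∷ [])

  blocks-idle : ∀ rs {s} → Run (blocks rs) s s
  blocks-idle []       = []
  blocks-idle (r ∷ rs) = run-++⁺ (block-idle r) (blocks-idle rs)

  blocks-apply : ∀ {i α rs s} → (i , α) ∈ rs → Run (blocks rs) (nt i ∷ s) (κ α ++ s)
  blocks-apply {i} {α} {_ ∷ rs} (here refl) = run-++⁺ (block-apply i α) (blocks-idle rs)
  blocks-apply {rs = r ∷ _}  (there m)   = run-++⁺ (block-idle r) (blocks-apply m)

  body-apply : ∀ {a i α} js s → (i , α) ∈ rules a →
               Run (body a) (enc (i ∷ js) ++ s) (enc (α ++ js) ++ s)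
  body-apply {a} {i} {α} js s m =
    run-++⁺ (blocks-apply m)
      (subst (λ t → Run (pop dollar ∷ pop hash ∷ []) (dollar ∷ t) (enc (α ++ js) ++ s))
             (sym (pre-enc α js s)) (pop ∷ pop ∷ []))

  gen⇒run : ∀ {js w} s → Gen js w → Run (List.concatMap ops w) (enc js ++ s) s
  gen⇒run s [] = []
  gen⇒run s (_∷_ {s = js} m g) =
    run-++⁺ (push ∷ take ∷ take ∷ take ∷ pop ∷ body-apply js s m) (gen⇒run s g)

  -- The first letter skips its optional pops and so leaves the start symbol on the stack. The
  -- lowest `bot` is missing here because the coding treats it separately, as the open argument of
  -- the target.
  gen⇒run₁ : ∀ {a w} → Gen [ S ] (a ∷ w) → Run (rest a ++ List.concatMap ops w) init []
  gen⇒run₁ (m ∷ g) = run-++⁺ (skip ∷ skip ∷ skip ∷ pop ∷ body-apply [] [] m) (gen⇒run [] g)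

  -- The pair of nt k and guard i is tolerated because erase (below) might still remove it; the bound
  -- rank i ≤ rank k excludes the pairs created by cover.
  data Ok : Sym I → Stack → Set where
    dollar : ∀ {s} → Ok dollar (hash ∷ s)
    nt     : ∀ {k s} → Ok (nt k) (hash ∷ s)
    nt-guard : ∀ {k i s} → rank i ≤ rank k → Ok (nt k) (guard i ∷ s)
    bot    : Ok bot []
    hash   : ∀ {s} → Ok hash s
    guard  : ∀ {i s} → Ok (guard i) s

  data Good : Stack → Set where
    []  : Good []
    _∷_ : ∀ {x s} → Ok x s → Good s → Good (x ∷ s)

  good-suffix : ∀ ρ {s} → Good (ρ ++ s) → Good s
  good-suffix []      g       = g
  good-suffix (x ∷ ρ) (_ ∷ g) = good-suffix ρ g

  Ranked : I × List I → Set
  Ranked (i , α) = LastAll (λ k → rank k < rank i) α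

  pre-last : ∀ {i} k α {s} → Ranked (i , k ∷ α) → Good (pre (k ∷ α) ++ s) →
             ∃ λ k′ → rank k′ < rank i × Ok (nt k′) s
  pre-last k []       q (_ ∷ o ∷ _) = k , q , o
  pre-last k (l ∷ α)  q (_ ∷ _ ∷ g) = pre-last l α q g

  data Under (i : I) : Stack → Set where
    hash  : ∀ {s} → Under i (hash ∷ s)
    guard : ∀ {j s} → rank j < rank i → Under i (guard j ∷ s)

  -- The lowest symbol of the body is `dollar` or a nonterminal of rank below that of `i`. In a good
  -- stack the former needs a `hash` beneath, and the latter tolerates only a `hash` or a guard of
  -- still smaller or equal rank.
  under : ∀ {i} α {s} → Ranked (i , α) → Good (κ α ++ s) → Under i s
  under []      q (dollar ∷ _) = hash
  under (k ∷ α) q (_ ∷ g) with pre-last k α q g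
  ... | k′ , l , nt         = hash
  ... | k′ , l , nt-guard m = guard (≤-trans (s≤s m) l)

  -- Only idle and apply are intended.
  data Outcome (i : I) (α : List I) : Stack → Stack → Set where
    idle  : ∀ {s} → Outcome i α s s
    apply : ∀ {s} → Outcome i α (nt i ∷ s) (κ α ++ s)
    cover : ∀ {s} → Outcome i α s (κ α ++ guard i ∷ s)
    over  : ∀ {s} → Outcome i α s (κ α ++ s)
    peel  : ∀ {s} → Outcome i α (guard i ∷ s) s
    erase : ∀ {s} → Outcome i α (nt i ∷ guard i ∷ s) s

  Unguarded : I → Stack → Set
  Unguarded i = All (guard i ≢_)

  κ-unguarded : ∀ i α → Unguarded i (κ α)
  κ-unguarded i α = (λ ()) ∷ go α
    where
    go : ∀ α → Unguarded i (pre α)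
    go []      = []
    go (k ∷ α) = (λ ()) ∷ (λ ()) ∷ go α

  opts-blocked : ∀ {i} ρ {s u} → Unguarded i ρ → Run (map opt ρ) (guard i ∷ s) u → u ≡ guard i ∷ s
  opts-blocked []      _       []         = refl
  opts-blocked (b ∷ ρ) (_ ∷ n) (skip ∷ r) = opts-blocked ρ n r
  opts-blocked (b ∷ ρ) (n ∷ _) (take ∷ r) = ⊥-elim (n refl)

  -- Compares lengths only.
  data _≼_ {A : Set} : List A → List A → Set where
    nil  : ∀ {xs} → [] ≼ xs
    cons : ∀ {x y xs ys} → xs ≼ ys → (x ∷ xs) ≼ (y ∷ ys)

  ≼-refl : ∀ {A : Set} (xs : List A) → xs ≼ xs
  ≼-refl []       = nil
  ≼-refl (x ∷ xs) = cons (≼-refl xs)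

  ≼-step : ∀ {A : Set} {xs ys : List A} {y} → xs ≼ ys → xs ≼ (y ∷ ys)
  ≼-step nil      = nil
  ≼-step (cons p) = cons (≼-step p)

  -- There are too few optional pops to reach below `π`, and `π` contains no `guard i`. So the final
  -- pop succeeds only after all of `π` is gone, and it finds its guard on top of `s`.
  opts-pop : ∀ {i} ρ π {s u v} → Unguarded i π → ρ ≼ π →
             Run (map opt ρ) (π ++ s) u → Run [ pop (guard i) ] u v → s ≡ guard i ∷ v
  opts-pop [] []      n nil [] (pop ∷ []) = refl
  opts-pop [] (x ∷ π) (n ∷ _) nil [] (pop ∷ []) = ⊥-elim (n refl)
  opts-pop (b ∷ ρ) (x ∷ π) n       (cons l) (skip ∷ r) q = opts-pop ρ (x ∷ π) n (≼-step l) r q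
  opts-pop (b ∷ ρ) (x ∷ π) (_ ∷ n) (cons l) (take ∷ r) q = opts-pop ρ π n l r q

  pushed : ∀ i α {s v} →
           Run (push (guard i ∷ κ α) ∷ opt (guard i) ∷ map opt (κ α) ++ [ pop (guard i) ]) s v →
           v ≡ κ α ++ s ⊎ s ≡ guard i ∷ v
  pushed i α (push ∷ skip ∷ r) with u , p , q ← run-++⁻ (map opt (κ α)) r
    with refl ← opts-blocked (κ α) (κ-unguarded i α) p with pop ∷ [] ← q = inj₁ refl
  pushed i α (push ∷ take ∷ r) with u , p , q ← run-++⁻ (map opt (κ α)) r =
    inj₂ (opts-pop (κ α) (κ α) (κ-unguarded i α) (≼-refl (κ α)) p q)

  outcome : ∀ i α {s v} → Run (block (i , α)) s v → Outcome i α s v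
  outcome i α (push ∷ skip ∷ skip ∷ r) with pushed i α r
  ... | inj₁ refl = cover
  ... | inj₂ refl = idle
  outcome i α (push ∷ take ∷ skip ∷ r) with pushed i α r
  ... | inj₁ refl = over
  ... | inj₂ refl = peel
  outcome i α (push ∷ take ∷ take ∷ r) with pushed i α r
  ... | inj₁ refl = apply
  ... | inj₂ refl = erase

  -- No outcome repairs a bad pair of neighbours, so goodness passes backwards from the final stack
  -- to all earlier ones.
  outcome-good : ∀ {i α s v} → Ranked (i , α) → Outcome i α s v → Good v → Good s
  outcome-good q idle g = g
  outcome-good {i} {α} q (apply {s}) g with under α q g
  ... | hash    = nt ∷ good-suffix (κ α) g
  ... | guard l = nt-guard (<⇒≤ l) ∷ good-suffix (κ α) g
  outcome-good {i} {α} q cover g with _ ∷ g′ ← good-suffix (κ α) g = g′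
  outcome-good {i} {α} q over  g = good-suffix (κ α) g
  outcome-good q peel  g = guard ∷ g
  outcome-good q erase g = nt-guard ≤-refl ∷ guard ∷ g

  blocks-good : ∀ rs {s v} → All Ranked rs → Run (blocks rs) s v → Good v → Good s
  blocks-good []       _        []  g = g
  blocks-good ((i , α) ∷ rs) (q ∷ qs) run g with _ , p , p′ ← run-++⁻ (block (i , α)) run =
    outcome-good q (outcome i α p) (blocks-good rs qs p′ g)

  all-ranked : ∀ a → All Ranked (rules a)
  all-ranked a = All.tabulate (λ m → ranked {a} m)

  body-good : ∀ a {s v} → Run (body a) s v → Good v → Good s
  body-good a run g with run-++⁻ (blocks (rules a)) run
  ... | _ , p , pop ∷ pop ∷ [] = blocks-good (rules a) (all-ranked a) p (dollar ∷ hash ∷ g)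

  data Start : Stack → Stack → Set where
    stay : ∀ {s} → Start s s
    seed : ∀ {s} → Start s (nt S ∷ hash ∷ bot ∷ s)

  start : ∀ a {s v} → Run (ops a) s v → ∃ λ t → Start s t × Run (body a) t v
  start a (push ∷ take ∷ take ∷ take ∷ pop ∷ r) = _ , stay , r
  start a (push ∷ skip ∷ skip ∷ skip ∷ pop ∷ r) = _ , seed , r

  start-good : ∀ {s t} → Start s t → Good t → Good s
  start-good stay g               = g
  start-good seed (_ ∷ _ ∷ _ ∷ g) = g

  run-good : ∀ w {s} → Run (List.concatMap ops w) s [ bot ] → Good s
  run-good []      [] = bot ∷ []
  run-good (a ∷ w) run with _ , p , p′ ← run-++⁻ (ops a) run with _ , st , r ← start a p =
    start-good st (body-good a r (run-good w p′))

  -- By `under`, the covered guard would have a rank below its own.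
  cover-bad : ∀ {i} α {s} → Ranked (i , α) → ¬ Good (κ α ++ guard i ∷ s)
  cover-bad α q g with guard l ← under α q g = <⇒≱ l ≤-refl

  data Closed : Stack → Set where
    []     : Closed []
    bot    : ∀ {s} → Closed (bot ∷ s)
    dollar : ∀ {s} → Closed (dollar ∷ s)

  closed-not-under : ∀ {i s} → Closed s → ¬ Under i s
  closed-not-under [] ()
  closed-not-under bot ()
  closed-not-under dollar ()

  -- `apply`, `peel` and `erase` need a nonterminal or a guard on top, and `over` needs a `hash` or
  -- a guard there for its result to be good.
  closed-outcome : ∀ {i α s v} → Ranked (i , α) → Closed s → Outcome i α s v → Good v → s ≡ v
  closed-outcome         q c idle  g = refl
  closed-outcome {α = α} q c cover g = ⊥-elim (cover-bad α q g)
  closed-outcome {α = α} q c over  g = ⊥-elim (closed-not-under c (under α q g))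

  closed-idle : ∀ rs {s v} → All Ranked rs → Closed s → Run (blocks rs) s v → Good v → s ≡ v
  closed-idle [] _ _ [] _ = refl
  closed-idle ((i , α) ∷ rs) (q ∷ qs) c run g with _ , p , p′ ← run-++⁻ (block (i , α)) run
    with refl ← closed-outcome q c (outcome i α p) (blocks-good rs qs p′ g) = closed-idle rs qs c p′ g

  body-closed : ∀ a {s v} → Closed s → (∀ {t} → s ≢ dollar ∷ t) → Run (body a) s v → ¬ Good v
  body-closed a c n run g with run-++⁻ (blocks (rules a)) run
  ... | _ , p , pop ∷ pop ∷ [] = n (closed-idle (rules a) (all-ranked a) c p (dollar ∷ hash ∷ g))

  -- With `nt j` directly on a `hash`, `peel` and `erase` are impossible, and `over` would put the
  -- body on a nonterminal. The final `dollar` forces some block to apply; from then on the stack is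
  -- closed, so no second one does.
  blocks-open : ∀ rs {j s v} → All Ranked rs → Run (blocks rs) (nt j ∷ hash ∷ s) (dollar ∷ v) →
                Good (dollar ∷ v) →
                ∃ λ α → (j , α) ∈ rs × v ≡ pre α ++ hash ∷ s
  blocks-open [] _ () _
  blocks-open ((i , α) ∷ rs) (q ∷ qs) run g with _ , p , p′ ← run-++⁻ (block (i , α)) run
    with outcome i α p | blocks-good rs qs p′ g
  ... | idle  | _  with β , m , e ← blocks-open rs qs p′ g = β , there m , e
  ... | cover | g′ = ⊥-elim (cover-bad α q g′)
  ... | over  | g′ with () ← under α q g′
  ... | apply | _ with refl ← closed-idle rs qs dollar p′ g = α , here refl , refl

  unfold : ∀ a w {s v} → Run (List.concatMap ops (a ∷ w)) s v →
           ∃ λ t → ∃ λ u → Start s t × Run (body a) t u × Run (List.concatMap ops w) u v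
  unfold a w run with u , p , q ← run-++⁻ (ops a) run with t , st , r ← start a p =
    t , u , st , r , q

  run⇒gen : ∀ w js → Run (List.concatMap ops w) (enc js ++ [ bot ]) [ bot ] → Gen js w
  run⇒gen [] [] [] = []
  run⇒gen [] (j ∷ js) ()
  run⇒gen (a ∷ w) [] run with unfold a w run
  ... | _ , _ , stay , r , q = ⊥-elim (body-closed a bot (λ ()) r (run-good w q))
  -- Seeding again would leave a `bot` above other symbols, which no good stack allows.
  ... | _ , _ , seed , r , q with _ ∷ _ ∷ () ∷ _ ← body-good a r (run-good w q)
  run⇒gen (a ∷ w) (j ∷ js) run with unfold a w run
  ... | _ , _ , seed , r , q with _ ∷ _ ∷ () ∷ _ ← body-good a r (run-good w q)
  run⇒gen (a ∷ w) (j ∷ js) run | _ , _ , stay , r , q with run-++⁻ (blocks (rules a)) r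
  ... | _ , r′ , pop ∷ pop ∷ []
    with α , m , e ← blocks-open (rules a) (all-ranked a) r′ (dollar ∷ hash ∷ run-good w q)
    with refl ← trans e (pre-enc α js [ bot ]) = m ∷ run⇒gen w (α ++ js) q

  run⇒gen₁ : ∀ a w → Run (List.concatMap ops (a ∷ w)) [] [ bot ] → Gen [ S ] (a ∷ w)
  run⇒gen₁ a w run with unfold a w run
  ... | _ , _ , stay , r , q = ⊥-elim (body-closed a [] (λ ()) r (run-good w q))
  ... | _ , _ , seed , r , q =
    -- The seeded stack is `enc [ S ]` on `bot`. The first letter is replayed from there, with its
    -- initial push undone at once.
    run⇒gen (a ∷ w) [ S ]
      (run-++⁺ (push ∷ take ∷ take ∷ take ∷ pop ∷ r) q)

-- Removing right recursion

data Words {Σ I : Set} (L : I → List Σ → Set) : List I → List Σ → Set where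
  []  : Words L [] []
  _∷_ : ∀ {i u s v} → L i u → Words L s v → Words L (i ∷ s) (u ++ v)

module _ {Σ I : Set} {L : I → List Σ → Set} where

  words-++⁺ : ∀ {s t u v} → Words L s u → Words L t v → Words L (s ++ t) (u ++ v)
  words-++⁺ [] q = q
  words-++⁺ {v = v} (_∷_ {u = u} {v = u′} x p) q =
    subst (Words L _) (sym (++-assoc u u′ v)) (x ∷ words-++⁺ p q)

  words-++⁻ : ∀ s {t w} → Words L (s ++ t) w →
              ∃ λ u → ∃ λ v → w ≡ u ++ v × Words L s u × Words L t v
  words-++⁻ []      q = [] , _ , refl , [] , q
  words-++⁻ (i ∷ s) (_∷_ {u = u} x p) with u′ , v , refl , p′ , q ← words-++⁻ s p =
    u ++ u′ , v , sym (++-assoc u u′ v) , x ∷ p′ , q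

  words-[]⁺ : ∀ {i w} → L i w → Words L [ i ] w
  words-[]⁺ {w = w} x = subst (Words L _) (++-identityʳ w) (x ∷ [])

  words-[]⁻ : ∀ {i w} → Words L [ i ] w → L i w
  words-[]⁻ (_∷_ {u = u} x []) = subst (L _) (sym (++-identityʳ u)) x

  words-∷ʳ⁻ : ∀ β {i w} → Words L (β ∷ʳ i) w →
              ∃ λ u → ∃ λ v → w ≡ u ++ v × Words L β u × L i v
  words-∷ʳ⁻ β p with u , v , e , p′ , q ← words-++⁻ β p = u , v , e , p′ , words-[]⁻ q

module _ {Σ I J : Set} {L : I → List Σ → Set} {M : J → List Σ → Set} {f : J → I} where

  words-map⁻ : (∀ {j w} → L (f j) w → M j w) → ∀ s {w} → Words L (map f s) w → Words M s w
  words-map⁻ g []      []      = []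
  words-map⁻ g (j ∷ s) (x ∷ p) = g x ∷ words-map⁻ g s p

-- Rules begin with a letter, so the symbol `j` cannot yield the empty word; leaving it out stands
-- for that word, and `P` says when this is allowed.
data Opt {J : Set} (j : J) (P : Set) : List J → Set where
  none : P → Opt j P []
  some : Opt j P [ j ]

module Trees {Σ I : Set} (R : Σ → I → List I → Set) where
  open Generation R

  data Tree : I → List Σ → Set where
    node : ∀ {a i α u} → R a i α → Words Tree α u → Tree i (a ∷ u)

  gen⇒words : ∀ {s w} → Gen s w → Words Tree s w
  gen⇒words [] = []
  gen⇒words (_∷_ {α = α} r g) with u , v , refl , p , q ← words-++⁻ α (gen⇒words g) =
    node r p ∷ q

  mutual
    tree⇒gen : ∀ {i w t v} → Tree i w → Gen t v → Gen (i ∷ t) (w ++ v)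
    tree⇒gen (node r p) g = r ∷ words⇒gen p g

    words⇒gen : ∀ {s w t v} → Words Tree s w → Gen t v → Gen (s ++ t) (w ++ v)
    words⇒gen []      g = g
    words⇒gen {t = t} {v} (_∷_ {u = u} {v = v′} x p) g =
      subst (Gen _) (sym (++-assoc u v′ v)) (tree⇒gen x (words⇒gen p g))

  gen⇒tree : ∀ {i w} → Gen [ i ] w → Tree i w
  gen⇒tree g = words-[]⁻ (gen⇒words g)

  tree⇒gen₁ : ∀ {i w} → Tree i w → Gen [ i ] w
  tree⇒gen₁ {w = w} x = subst (Gen _) (++-identityʳ w) (tree⇒gen x [])

  module _ {L : I → List Σ → Set}
           (closed : ∀ {a i α u} → R a i α → Words L α u → L i (a ∷ u)) where
    mutual
      -- Trees form the least family closed under the rules, so a transformed grammar is sound once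
      -- each single rule respects the intended languages.
      tree-sound : ∀ {i w} → Tree i w → L i w
      tree-sound (node r p) = closed r (words-sound p)

      words-sound : ∀ {s w} → Words Tree s w → Words L s w
      words-sound []      = []
      words-sound (x ∷ p) = tree-sound x ∷ words-sound p

gen-map : ∀ {Σ I : Set} {R R′ : Σ → I → List I → Set} → (∀ {a i α} → R a i α → R′ a i α) →
          ∀ {s w} → Generation.Gen R s w → Generation.Gen R′ s w
gen-map f Generation.[]      = Generation.[]
gen-map f (r Generation.∷ g) = f r Generation.∷ gen-map f g

-- Cutting trees along their right spines

data Spinal (Σ I : Set) : Set where
  letter : Σ → Spinal Σ I
  whole  : I → Spinal Σ I
  chain  : I → I → Spinal Σ I

module RightSpine {Σ I : Set} (R : Σ → I → List I → Set) where
  open Trees R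

  -- `spine` names the first rule of a right spine and the letter that ends it; `more` names the
  -- first and the last rule of a chain. What lies between is again a chain, and it never stands at
  -- the end of a body.
  data Rule : Σ → Spinal Σ I → List (Spinal Σ I) → Set where
    letter : ∀ {b} → Rule b (letter b) []
    leaf   : ∀ {a A} → R a A [] → Rule a (whole A) []
    spine  : ∀ {a A β A₁ C o b} → R a A (β ∷ʳ A₁) → Opt (chain C A₁) (C ≡ A₁) o → R b C [] →
             Rule a (whole A) (map whole β ++ o ++ letter b ∷ [])
    one    : ∀ {a A β Z} → R a A (β ∷ʳ Z) → Rule a (chain Z A) (map whole β)
    more   : ∀ {a A β A₁ Z o b Y γ} → R a A (β ∷ʳ A₁) → Opt (chain Y A₁) (Y ≡ A₁) o →
             R b Y (γ ∷ʳ Z) → Rule a (chain Z A) (map whole β ++ o ++ letter b ∷ map whole γ)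

  rank : Spinal Σ I → ℕ
  rank (letter _)  = 0
  rank (whole _)   = 1
  rank (chain _ _) = 2

  lastAll-whole : ∀ {Q : Spinal Σ I → Set} → (∀ {i} → Q (whole i)) → ∀ β → LastAll Q (map whole β)
  lastAll-whole q []          = tt
  lastAll-whole q (i ∷ [])    = q
  lastAll-whole q (i ∷ j ∷ β) = lastAll-whole q (j ∷ β)

  lastAll-++ : ∀ {A : Set} {Q : A → Set} s {t} → t ≢ [] → LastAll Q t → LastAll Q (s ++ t)
  lastAll-++ []          n q = q
  lastAll-++ (y ∷ []) {[]}    n q = ⊥-elim (n refl)
  lastAll-++ (y ∷ []) {z ∷ t} n q = q
  lastAll-++ (y ∷ z ∷ s)      n q = lastAll-++ (z ∷ s) n q

  lastAll-∷ : ∀ {A : Set} {Q : A → Set} {x} t → Q x → LastAll Q t → LastAll Q (x ∷ t)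
  lastAll-∷ []      q _ = q
  lastAll-∷ (y ∷ t) _ q = q

  ++-∷≢[] : ∀ {A : Set} (s : List A) {x t} → s ++ x ∷ t ≢ []
  ++-∷≢[] []      ()
  ++-∷≢[] (_ ∷ _) ()

  ranked : ∀ {a i α} → Rule a i α → LastAll (λ k → rank k < rank i) α
  ranked letter   = tt
  ranked (leaf _) = tt
  ranked (spine {β = β} {o = o} _ _ _) =
    lastAll-++ (map whole β) (++-∷≢[] o) (lastAll-++ o (λ ()) ≤-refl)
  ranked (one {β = β} _) = lastAll-whole ≤-refl β
  ranked (more {β = β} {o = o} {γ = γ} _ _ _) =
    lastAll-++ (map whole β) (++-∷≢[] o)
      (lastAll-++ o (λ ()) (lastAll-∷ (map whole γ) (s≤s z≤n) (lastAll-whole ≤-refl γ)))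

  -- The word to the left of Z on the right spine from A down to Z.
  data Chain (Z : I) : I → List Σ → Set where
    nil  : Chain Z Z []
    cons : ∀ {a A β A₁ v u} → R a A (β ∷ʳ A₁) → Words Tree β v → Chain Z A₁ u →
           Chain Z A (a ∷ v ++ u)

  chain-trans : ∀ {Z A Y u v} → Chain Z A u → Chain Y Z v → Chain Y A (u ++ v)
  chain-trans nil q = q
  chain-trans {v = v} (cons {v = v₁} {u = u₁} r p c) q =
    subst (Chain _ _) (cong (_ ∷_) (sym (++-assoc v₁ u₁ v))) (cons r p (chain-trans c q))

  chain-tree : ∀ {Z A u v} → Chain Z A u → Tree Z v → Tree A (u ++ v)
  chain-tree nil x = x
  chain-tree {v = v} (cons {v = v₁} {u = u₁} r p c) x =
    subst (Tree _) (cong (_ ∷_) (sym (++-assoc v₁ u₁ v)))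
      (node r (words-++⁺ p (words-[]⁺ (chain-tree c x))))

  Lang : Spinal Σ I → List Σ → Set
  Lang (letter b)  w = w ≡ [ b ]
  Lang (whole A)   w = Tree A w
  Lang (chain Z A) w = Chain Z A w

  opt-chain : ∀ {C A o u} → Opt (chain C A) (C ≡ A) o → Words Lang o u → Chain C A u
  opt-chain (none refl) []       = nil
  opt-chain some        (c ∷ []) = subst (Chain _ _) (sym (++-identityʳ _)) c

  wholes : ∀ β {w} → Words Lang (map whole β) w → Words Tree β w
  wholes = words-map⁻ (λ x → x)

  rule-sound : ∀ {a i α u} → Rule a i α → Words Lang α u → Lang i (a ∷ u)
  rule-sound letter   [] = refl
  rule-sound (leaf r) [] = node r []
  rule-sound (spine {β = β} {o = o} r x r′) p
    with v , _ , refl , q , p′ ← words-++⁻ (map whole β) p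
    with u , _ , refl , q′ , refl ∷ [] ← words-++⁻ o p′ =
      node r (words-++⁺ (wholes β q) (words-[]⁺ (chain-tree (opt-chain x q′) (node r′ []))))
  rule-sound (one {β = β} r) p =
    subst (Chain _ _) (cong (_ ∷_) (++-identityʳ _)) (cons r (wholes β p) nil)
  rule-sound (more {β = β} {o = o} {γ = γ} r x r′) p
    with v , _ , refl , q , p′ ← words-++⁻ (map whole β) p
    with u , _ , refl , q′ , refl ∷ p″ ← words-++⁻ o p′ =
      cons r (wholes β q) (chain-trans (opt-chain x q′)
        (subst (Chain _ _) (cong (_ ∷_) (++-identityʳ _)) (cons r′ (wholes γ p″) nil)))

  open Trees Rule using () renaming (Tree to Tree′; node to node′; tree-sound to tree′-sound)

  sound : ∀ {A w} → Tree′ (whole A) w → Tree A w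
  sound = tree′-sound {L = Lang} rule-sound

  infix 4 _⊑_
  _⊑_ : List Σ → ℕ → Set
  w ⊑ n = length w ≤ n

  ⊑ˡ : ∀ {n} u {v} → u ++ v ⊑ n → u ⊑ n
  ⊑ˡ u l = ≤-trans (≤-trans (m≤m+n _ _) (≤-reflexive (sym (length-++ u)))) l

  ⊑ʳ : ∀ {n} u {v} → u ++ v ⊑ n → v ⊑ n
  ⊑ʳ u l = ≤-trans (≤-trans (m≤n+m _ (length u)) (≤-reflexive (sym (length-++ u)))) l

  -- The spine ends at a rule with empty body. Here and in `complete` the recursion is on a bound
  -- for the length of the word, as splitting off the last tree hides that it is a subtree.
  descend : ∀ n {A w} → w ⊑ n → Tree A w →
            ∃ λ C → ∃ λ b → ∃ λ u → w ≡ u ∷ʳ b × Chain C A u × R b C []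
  descend (suc n) (s≤s l) (node {α = α} r p) with initLast α
  descend (suc n) (s≤s l) (node r []) | [] = _ , _ , [] , refl , nil , r
  ... | β ∷ʳ′ A₁ with v , t , refl , q , x ← words-∷ʳ⁻ β p
    with C , b , u , refl , c , r′ ← descend n (⊑ʳ v l) x =
      C , b , _ ∷ v ++ u , cong (_ ∷_) (sym (++-assoc v u [ b ])) , cons r q c , r′

  -- A chain seen from its lower end, where `more` needs the last rule.
  data Last (Z A : I) : List Σ → Set where
    nil  : Z ≡ A → Last Z A []
    snoc : ∀ {Y b γ u v} → Chain Y A u → R b Y (γ ∷ʳ Z) → Words Tree γ v → Last Z A (u ++ b ∷ v)

  last : ∀ {Z A u} → Chain Z A u → Last Z A u
  last nil = nil refl
  last (cons {v = v} r p c) with last c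
  ... | nil refl = subst (Last _ _) (cong (_ ∷_) (sym (++-identityʳ v))) (snoc nil r p)
  ... | snoc {u = u} c′ r′ p′ =
    subst (Last _ _) (cong (_ ∷_) (++-assoc v u _)) (snoc (cons r p c′) r′ p′)

  mutual
    complete : ∀ n {A w} → w ⊑ n → Tree A w → Tree′ (whole A) w
    complete (suc n) (s≤s l) (node {α = α} r p) with initLast α
    complete (suc n) (s≤s l) (node r []) | [] = node′ (leaf r) []
    ... | β ∷ʳ′ A₁ with v , t , refl , q , x ← words-∷ʳ⁻ β p
      with C , b , u , refl , c , r′ ← descend n (⊑ʳ v l) x
      with o , y , q′ ← complete-chain n (⊑ˡ u (⊑ʳ v l)) c =
        node′ (spine r y r′)
          (words-++⁺ (complete-words n (⊑ˡ v l) q)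
             (words-++⁺ q′ (words-[]⁺ (node′ letter []))))

    complete-words : ∀ n {β w} → w ⊑ n → Words Tree β w → Words Tree′ (map whole β) w
    complete-words n l []                = []
    complete-words n l (_∷_ {u = u} x p) =
      complete n (⊑ˡ u l) x ∷ complete-words n (⊑ʳ u l) p

    complete-chain : ∀ n {Z A u} → u ⊑ n → Chain Z A u →
                     ∃ λ o → Opt (chain Z A) (Z ≡ A) o × Words Tree′ o u
    complete-chain n l nil = [] , none refl , []
    complete-chain (suc n) (s≤s l) (cons {v = v} r p c) with last c
    ... | nil refl = _ , some , words-[]⁺ (node′ (one r)
            (subst (Words _ _) (sym (++-identityʳ v)) (complete-words n (⊑ˡ v l) p)))
    ... | snoc {u = u} c′ r′ p′ with o , y , q ← complete-chain n (⊑ˡ u (⊑ʳ v l)) c′ =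
      _ , some , words-[]⁺ (node′ (more r y r′)
        (words-++⁺ (complete-words n (⊑ˡ v l) p)
          (words-++⁺ q (node′ letter [] ∷ complete-words n (≤-trans (n≤1+n _) (⊑ʳ u (⊑ʳ v l))) p′))))

-- Removing left recursion

data Corner (K : Set) : Set where
  root  : Corner K
  corner : K → K → Corner K

module LeftCorner {Σ K : Set} (Lex : K → Σ → Set) (Bin : K → K → K → Set) (S : K) where

  data BTree : K → List Σ → Set where
    leaf : ∀ {A a} → Lex A a → BTree A [ a ]
    node : ∀ {A C D u v} → Bin A C D → BTree C u → BTree D v → BTree A (u ++ v)

  -- The left-corner transformation: `corner X A` yields what follows an `X` at the left end of an
  -- `A`. Its body begins with the first letter of the right sibling `C` of `X`, whence no left
  -- recursion.
  data Rule : Σ → Corner K → List (Corner K) → Set where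
    root : ∀ {a P o} → Lex P a → Opt (corner P S) (P ≡ S) o → Rule a root o
    step  : ∀ {a X A B C P o o′} → Bin B X C → Lex P a → Opt (corner P C) (P ≡ C) o →
            Opt (corner B A) (B ≡ A) o′ → Rule a (corner X A) (o ++ o′)

  -- The yields of the right siblings along a left spine from X up to A.
  data Spine (X : K) : K → List Σ → Set where
    nil  : Spine X X []
    cons : ∀ {A B C P c v u} → Bin B X C → Lex P c → Spine P C v → Spine B A u →
           Spine X A (c ∷ v ++ u)

  spine-trans : ∀ {X B A u v} → Spine X B u → Spine B A v → Spine X A (u ++ v)
  spine-trans nil q = q
  spine-trans {v = v} (cons {v = v₁} {u = u₁} b l s p) q =
    subst (Spine _ _) (cong (_ ∷_) (sym (++-assoc v₁ u₁ v))) (cons b l s (spine-trans p q))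

  spine-tree : ∀ {X A u v} → Spine X A u → BTree X v → BTree A (v ++ u)
  spine-tree {v = v} nil x = subst (BTree _) (sym (++-identityʳ v)) x
  spine-tree {v = v} (cons {v = v₁} {u = u₁} b l s p) x =
    subst (BTree _) (++-assoc v (_ ∷ v₁) u₁)
      (spine-tree p (node b x (spine-tree s (leaf l))))

  tree-spine : ∀ {A w} → BTree A w →
               ∃ λ P → ∃ λ a → ∃ λ u → w ≡ a ∷ u × Lex P a × Spine P A u
  tree-spine (leaf l) = _ , _ , [] , refl , l , nil
  tree-spine (node b x y)
    with P , a , u , refl , l , s ← tree-spine x
    with Q , c , v , refl , l′ , s′ ← tree-spine y =
      P , a , _ , refl , l ,
      -- The left spine of the left child grows by one step at its upper end, with `D` as the new
      -- sibling.
      subst (λ v → Spine _ _ (u ++ _ ∷ v)) (++-identityʳ v) (spine-trans s (cons b l′ s′ nil))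

  Lang : Corner K → List Σ → Set
  Lang root        w = BTree S w
  Lang (corner X A) w = Spine X A w

  opt-spine : ∀ {X A o u} → Opt (corner X A) (X ≡ A) o → Words Lang o u → Spine X A u
  opt-spine (none refl) []       = nil
  opt-spine some        (s ∷ []) = subst (Spine _ _) (sym (++-identityʳ _)) s

  rule-sound : ∀ {a i α u} → Rule a i α → Words Lang α u → Lang i (a ∷ u)
  rule-sound (root l x) p = spine-tree (opt-spine x p) (leaf l)
  rule-sound (step {o = o} b l x y) p with u , v , refl , q , q′ ← words-++⁻ o p =
    cons b l (opt-spine x q) (opt-spine y q′)

  open Trees Rule

  sound : ∀ {w} → Tree root w → BTree S w
  sound = tree-sound {L = Lang} rule-sound

  complete-spine : ∀ {X A u} → Spine X A u → ∃ λ o → Opt (corner X A) (X ≡ A) o × Words Tree o u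
  complete-spine nil = [] , none refl , []
  complete-spine (cons b l s p)
    with o , x , q ← complete-spine s
    with o′ , y , q′ ← complete-spine p =
      _ , some , words-[]⁺ (node (step b l x y) (words-++⁺ q q′))

  complete : ∀ {w} → BTree S w → Tree root w
  complete t with P , a , u , refl , l , s ← tree-spine t
    with o , x , q ← complete-spine s = node (root l x) q

-- Finite sets and finite lists

finite-≟ : ∀ {A} → Finite A → DecidableEquality A
finite-≟ (_ , i) = via-injection (↔⇒↣ i) Fin._≟_

finite-↔ : ∀ {A B : Set} → A ↔ B → Finite B → Finite A
finite-↔ i (n , j) = n , (j ↔-∘ i)

finite-⊎ : ∀ {A B} → Finite A → Finite B → Finite (A ⊎ B)
finite-⊎ (m , i) (n , j) = m + n , (↔-sym (+↔⊎ {m} {n}) ↔-∘ (i ⊎-↔ j))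

finite-× : ∀ {A B} → Finite A → Finite B → Finite (A × B)
finite-× (m , i) (n , j) = _ , (↔-sym (*↔× {m} {n}) ↔-∘ (i ×-↔ j))

finite-Fin : ∀ n → Finite (Fin n)
finite-Fin n = n , mk↔ₛ′ id id (λ _ → refl) (λ _ → refl)

finite-any? : ∀ {A} → Finite A → {P : A → Set} → Decidable P → Dec (∃ P)
finite-any? (_ , i) {P} P? =
  map′ (λ (k , p) → Inverse.from i k , p)
       (λ (a , p) → Inverse.to i a , subst P (sym (Inverse.strictlyInverseʳ i a)) p)
       (any? (λ k → P? (Inverse.from i k)))

elements : ∀ {A} → Finite A → List A
elements (n , i) = map (Inverse.from i) (allFin n)

∈-elements : ∀ {A} (f : Finite A) a → a ∈ elements f
∈-elements (n , i) a =
  subst (_∈ _) (Inverse.strictlyInverseʳ i a) (∈-map⁺ (Inverse.from i) (∈-allFin (Inverse.to i a)))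

-- The grammars are defined as relations, which suit pattern matching, while the machine needs
-- finite lists of rules; a `Listing` connects the two.
record Listing {A : Set} (P : A → Set) : Set where
  field
    list          : List A
    list-sound    : ∀ {a} → a ∈ list → P a
    list-complete : ∀ {a} → P a → a ∈ list

open Listing

module _ {A : Set} where

  listed : (xs : List A) → Listing (_∈ xs)
  listed xs = record { list = xs ; list-sound = id ; list-complete = id }

  pure : (a : A) → Listing (_≡ a)
  pure a = record { list = [ a ] ; list-sound = λ { (here e) → e } ; list-complete = here }

  none-of : {P : A → Set} → (∀ {a} → ¬ P a) → Listing P
  none-of n = record { list = [] ; list-sound = λ () ; list-complete = λ p → ⊥-elim (n p) }

  transport : {P Q : A → Set} → (∀ {a} → P a → Q a) → (∀ {a} → Q a → P a) → Listing P → Listing Q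
  transport f g l = record
    { list          = list l
    ; list-sound    = f ∘ list-sound l
    ; list-complete = list-complete l ∘ g
    }

  union : {P Q : A → Set} → Listing P → Listing Q → Listing (λ a → P a ⊎ Q a)
  union l m = record
    { list          = list l ++ list m
    ; list-sound    = λ i → [ inj₁ ∘ list-sound l , inj₂ ∘ list-sound m ]′ (∈-++⁻ (list l) i)
    ; list-complete = [ ∈-++⁺ˡ ∘ list-complete l , ∈-++⁺ʳ (list l) ∘ list-complete m ]′
    }

  decidable : Finite A → {P : A → Set} → Decidable P → Listing P
  decidable f P? = record
    { list          = filter P? (elements f)
    ; list-sound    = λ i → proj₂ (∈-filter⁻ P? {xs = elements f} i)
    ; list-complete = ∈-filter⁺ P? (∈-elements f _)
    }

  guarded : {P : A → Set} {Q : Set} → Dec Q → Listing P → Listing (λ a → Q × P a)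
  guarded (yes q) l = transport (q ,_) proj₂ l
  guarded (no ¬q) l = none-of (¬q ∘ proj₁)

bind : ∀ {A B : Set} {P : A → Set} {Q : A → B → Set} → Listing P → (∀ a → Listing (Q a)) →
       Listing (λ b → ∃ λ a → P a × Q a b)
bind l m = record
  { list          = List.concatMap (list ∘ m) (list l)
  ; list-sound    = λ i → let a , j , k = find (∈-concatMap⁻ (list ∘ m) {list l} i) in
                     a , list-sound l j , list-sound (m a) k
  ; list-complete = λ (a , p , q) →
      ∈-concatMap⁺ (list ∘ m) (lose (list-complete l p) (list-complete (m a) q))
  }

snoc-listing : ∀ {A : Set} (α : List A) → Listing (λ ((β , k) : List A × A) → α ≡ β ∷ʳ k)
snoc-listing α with initLast α
... | []      = none-of λ { {[] , _} () ; {_ ∷ _ , _} () }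
... | β ∷ʳ′ k = transport (λ { refl → refl })
  (λ e → let e₁ , e₂ = ∷ʳ-injective _ _ e in cong₂ _,_ (sym e₁) (sym e₂)) (pure (β , k))

-- Forward chaining: derivability from finitely many Horn clauses is decidable.
module Horn {A : Set} (_≟_ : DecidableEquality A) {Clause : List A × A → Set}
            (clauses : Listing Clause) where

  open DecMembership _≟_ using (_∈?_)

  data Derivable : A → Set where
    by : ∀ {ps a} → Clause (ps , a) → All Derivable ps → Derivable a

  data Pick {B : Set} (x : B) : List B → List B → Set where
    here  : ∀ {xs} → Pick x (x ∷ xs) xs
    there : ∀ {y xs ys} → Pick x xs ys → Pick x (y ∷ xs) (y ∷ ys)

  pick-∈ : ∀ {B : Set} {x y : B} {xs ys} → Pick x xs ys → y ∈ xs → y ≡ x ⊎ y ∈ ys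
  pick-∈ here      (here e)  = inj₁ e
  pick-∈ here      (there m) = inj₂ m
  pick-∈ (there p) (here e)  = inj₂ (here e)
  pick-∈ (there p) (there m) with pick-∈ p m
  ... | inj₁ e = inj₁ e
  ... | inj₂ n = inj₂ (there n)

  pick-⊆ : ∀ {B : Set} {x y : B} {xs ys} → Pick x xs ys → y ∈ ys → y ∈ xs
  pick-⊆ here      m         = there m
  pick-⊆ (there p) (here e)  = here e
  pick-⊆ (there p) (there m) = there (pick-⊆ p m)

  pick-self : ∀ {B : Set} {x : B} {xs ys} → Pick x xs ys → x ∈ xs
  pick-self here      = here refl
  pick-self (there p) = there (pick-self p)

  pick-length : ∀ {B : Set} {x : B} {xs ys} → Pick x xs ys → length xs ≡ suc (length ys)
  pick-length here      = refl
  pick-length (there p) = cong suc (pick-length p)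

  pick? : ∀ {B : Set} {P : B → Set} → Decidable P → ∀ xs →
          (∃ λ x → ∃ λ ys → P x × Pick x xs ys) ⊎ (∀ {x} → x ∈ xs → ¬ P x)
  pick? P? [] = inj₂ λ ()
  pick? P? (x ∷ xs) with P? x
  ... | yes p = inj₁ (x , xs , p , here)
  ... | no ¬p with pick? P? xs
  ...   | inj₁ (y , ys , p , q) = inj₁ (y , x ∷ ys , p , there q)
  ...   | inj₂ n = inj₂ λ { (here refl) → ¬p ; (there m) → n m }

  Saturated : List A → Set
  Saturated D = ∀ {ps a} → Clause (ps , a) → All (_∈ D) ps → a ∈ D

  saturate : ∀ n (todo : List (List A × A)) → length todo ≡ n → (∀ {c} → c ∈ todo → Clause c) →
             (D : List A) → All Derivable D →
             (∀ {ps a} → Clause (ps , a) → (ps , a) ∈ todo ⊎ a ∈ D) →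
             ∃ λ D → All Derivable D × Saturated D
  saturate n todo len ok D ds cover with pick? (λ (ps , _) → all? (_∈? D) ps) todo
  ... | inj₂ stuck = D , ds , λ c ps∈D → [ (λ m → ⊥-elim (stuck m ps∈D)) , id ]′ (cover c)
  saturate zero [] len ok D ds cover | inj₁ (_ , _ , _ , ())
  saturate (suc n) todo len ok D ds cover | inj₁ ((ps , a) , todo′ , ps∈D , p) =
    saturate n todo′ (suc-injective (trans (sym (pick-length p)) len)) (ok ∘ pick-⊆ p) (a ∷ D)
      (by (ok (pick-self p)) (All.map (All.lookup ds) ps∈D) ∷ ds)
      λ c → [ (λ m → [ (λ { refl → inj₂ (here refl) }) , inj₁ ]′ (pick-∈ p m))
            , inj₂ ∘ there ]′ (cover c)

  saturation : ∃ λ D → All Derivable D × Saturated D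
  saturation = saturate _ (list clauses) refl (list-sound clauses) [] [] (inj₁ ∘ list-complete clauses)

  mutual
    derivable-∈ : ∀ {a} → Derivable a → a ∈ proj₁ saturation
    derivable-∈ (by c ds) = proj₂ (proj₂ saturation) c (derivable-∈* ds)

    derivable-∈* : ∀ {as} → All Derivable as → All (_∈ proj₁ saturation) as
    derivable-∈* []       = []
    derivable-∈* (d ∷ ds) = derivable-∈ d ∷ derivable-∈* ds

  derivable? : Decidable Derivable
  derivable? a =
    map′ (All.lookup (proj₁ (proj₂ saturation))) derivable-∈ (a ∈? proj₁ saturation)

-- Binarisation

module Yield {Σ : Set} (G : ContextFreeGrammar Σ) where
  open ContextFreeGrammar G

  data Derives : SententialForm → List Σ → Set where
    []     : Derives [] []
    term   : ∀ {a α w} → Derives α w → Derives (inj₂ a ∷ α) (a ∷ w)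
    expand : ∀ {A β α u w} → (A , β) ∈ rules → Derives β u → Derives α w →
             Derives (inj₁ A ∷ α) (u ++ w)

  derives-++⁺ : ∀ {α β u v} → Derives α u → Derives β v → Derives (α ++ β) (u ++ v)
  derives-++⁺ []       q = q
  derives-++⁺ (term p) q = term (derives-++⁺ p q)
  derives-++⁺ {v = v} (expand {u = u} {w} r p p′) q =
    subst (Derives _) (sym (++-assoc u w v)) (expand r p (derives-++⁺ p′ q))

  derives-++⁻ : ∀ α {β w} → Derives (α ++ β) w →
                ∃ λ u → ∃ λ v → w ≡ u ++ v × Derives α u × Derives β v
  derives-++⁻ [] q = [] , _ , refl , [] , q
  derives-++⁻ (inj₂ a ∷ α) (term p) with u , v , refl , p′ , q ← derives-++⁻ α p =
    a ∷ u , v , refl , term p′ , q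
  derives-++⁻ (inj₁ A ∷ α) (expand {u = u} r p₀ p) with u′ , v , refl , p′ , q ← derives-++⁻ α p =
    u ++ u′ , v , sym (++-assoc u u′ v) , expand r p₀ p′ , q

  derives-terminals : ∀ w → Derives (map inj₂ w) w
  derives-terminals []      = []
  derives-terminals (a ∷ w) = term (derives-terminals w)

  derives-⇒ : ∀ {α β w} → α ⇒ β → Derives β w → Derives α w
  derives-⇒ (rewriteAt η θ {α = α} r) p
    with u , v , refl , q , q′ ← derives-++⁻ η p
    with v₁ , v₂ , refl , q₁ , q₂ ← derives-++⁻ α q′ = derives-++⁺ q (expand r q₁ q₂)

  ⇒*-derives : ∀ {α w} → α ⇒* map inj₂ w → Derives α w
  ⇒*-derives {w = w} s = go s (derives-terminals w)
    where
    go : ∀ {α β w} → α ⇒* β → Derives β w → Derives α w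
    go ε        p = p
    go (s ◅ ss) p = derives-⇒ s (go ss p)

  ∷-⇒ : ∀ X {α β} → α ⇒ β → (X ∷ α) ⇒ (X ∷ β)
  ∷-⇒ X (rewriteAt η θ r) = rewriteAt (X ∷ η) θ r

  ++-⇒ : ∀ γ {α β} → α ⇒ β → (α ++ γ) ⇒ (β ++ γ)
  ++-⇒ γ (rewriteAt η θ {A} {α} r)
    rewrite ++-assoc η (inj₁ A ∷ θ) γ | ++-assoc η (α ++ θ) γ | ++-assoc α θ γ =
      rewriteAt η (θ ++ γ) r

  ++ˡ-⇒* : ∀ η {α β} → α ⇒* β → (η ++ α) ⇒* (η ++ β)
  ++ˡ-⇒* []      s = s
  ++ˡ-⇒* (X ∷ η) s = gmap (X ∷_) (∷-⇒ X) (++ˡ-⇒* η s)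

  derives-⇒* : ∀ {α w} → Derives α w → α ⇒* map inj₂ w
  derives-⇒* []       = ε
  derives-⇒* (term p) = gmap (_ ∷_) (∷-⇒ _) (derives-⇒* p)
  derives-⇒* (expand {A} {β} {α} {u} {w} r p q) =
    rewriteAt [] α r ◅
    (gmap (_++ α) (++-⇒ α) (derives-⇒* p) ◅◅
     subst (λ γ → (map inj₂ u ++ α) ⇒* γ) (sym (map-++ inj₂ u w)) (++ˡ-⇒* (map inj₂ u) (derives-⇒* q)))

module Binarise {Σ : Set} (finiteΣ : Finite Σ) (G : ContextFreeGrammar Σ) where
  open ContextFreeGrammar G
  open Yield G

  _≟ˢ_ : DecidableEquality (N ⊎ Σ)
  _≟ˢ_ = Sum.≡-dec (finite-≟ finiteN) (finite-≟ finiteΣ)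

  _≟ᶠ_ : DecidableEquality SententialForm
  _≟ᶠ_ = ≡-dec _≟ˢ_

  data NullClause : List (N ⊎ Σ) × (N ⊎ Σ) → Set where
    rule : ∀ {A β} → (A , β) ∈ rules → NullClause (β , inj₁ A)

  nullClauses : Listing NullClause
  nullClauses = transport (λ { ((A , β) , r , refl) → rule r }) (λ { (rule r) → _ , r , refl })
    (bind (listed rules) (λ (A , β) → pure (β , inj₁ A)))

  open Horn _≟ˢ_ nullClauses using () renaming (by to null-by; Derivable to Nullable; derivable? to nullable?)

  mutual
    nullable-sound : ∀ {X} → Nullable X → Derives [ X ] []
    nullable-sound (null-by (rule r) ns) = expand r (nullables-sound ns) []

    nullables-sound : ∀ {α} → All Nullable α → Derives α []
    nullables-sound []       = []
    nullables-sound (n ∷ ns) = derives-++⁺ (nullable-sound n) (nullables-sound ns)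

  -- The empty word enters through an equation, since `expand` has a concatenation as its index.
  nullables-complete : ∀ {α w} → Derives α w → w ≡ [] → All Nullable α
  nullables-complete [] _ = []
  nullables-complete (expand {u = []} r p q) e =
    null-by (rule r) (nullables-complete p refl) ∷ nullables-complete q e

  null? : ∀ α → Dec (Derives α [])
  null? α = map′ nullables-sound (λ p → nullables-complete p refl) (all? nullable? α)

  -- Closed under splitting a form into its first symbol and the remainder, which is how binary
  -- nodes arise.
  parts : SententialForm → List SententialForm
  parts []      = [ [] ]
  parts (X ∷ α) = (X ∷ α) ∷ [ X ] ∷ parts α

  parts-self : ∀ α → α ∈ parts α
  parts-self []      = here refl
  parts-self (X ∷ α) = here refl

  parts-head : ∀ {X α} β → X ∷ α ∈ parts β → [ X ] ∈ parts β
  parts-head []      (here ())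
  parts-head (Y ∷ β) (here refl)         = there (here refl)
  parts-head (Y ∷ β) (there (here refl)) = there (here refl)
  parts-head (Y ∷ β) (there (there m))   = there (there (parts-head β m))

  []∈parts : ∀ α → [] ∈ parts α
  []∈parts []      = here refl
  []∈parts (X ∷ α) = there (there ([]∈parts α))

  parts-tail : ∀ {X α} β → X ∷ α ∈ parts β → α ∈ parts β
  parts-tail []      (here ())
  parts-tail (Y ∷ β) (here refl)         = there (there (parts-self β))
  parts-tail (Y ∷ β) (there (here refl)) = there (there ([]∈parts β))
  parts-tail (Y ∷ β) (there (there m))   = there (there (parts-tail β m))

  forms : List SententialForm
  forms = List.concatMap parts ([ inj₁ start ] ∷ map proj₂ rules)

  K : Set
  K = Fin (length forms)

  form : K → SententialForm
  form = lookup forms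

  ∈-forms : ∀ {α} k → form k ≡ α → α ∈ forms
  ∈-forms k refl = ∈-lookup k

  at : ∀ {α} → α ∈ forms → ∃ λ k → form k ≡ α
  at m = index m , sym (lookup-index m)

  forms-start : [ inj₁ start ] ∈ forms
  forms-start = ∈-concatMap⁺ parts {[ inj₁ start ] ∷ map proj₂ rules} (here (parts-self _))

  forms-body : ∀ {A β} → (A , β) ∈ rules → β ∈ forms
  forms-body r = ∈-concatMap⁺ parts {[ inj₁ start ] ∷ map proj₂ rules}
    (there (lose (∈-map⁺ proj₂ r) (parts-self _)))

  forms-head : ∀ {X α} → X ∷ α ∈ forms → [ X ] ∈ forms
  forms-head m with β , i , j ← find (∈-concatMap⁻ parts {[ inj₁ start ] ∷ map proj₂ rules} m) =
    ∈-concatMap⁺ parts {[ inj₁ start ] ∷ map proj₂ rules} (lose i (parts-head β j))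

  forms-tail : ∀ {X α} → X ∷ α ∈ forms → α ∈ forms
  forms-tail m with β , i , j ← find (∈-concatMap⁻ parts {[ inj₁ start ] ∷ map proj₂ rules} m) =
    ∈-concatMap⁺ parts {[ inj₁ start ] ∷ map proj₂ rules} (lose i (parts-tail β j))

  -- Reach γ α: α becomes γ by rewriting and erasing nullable symbols.
  data Reach (γ : SententialForm) : SententialForm → Set where
    stop : Reach γ γ
    skip : ∀ {X α} → Derives [ X ] [] → Reach γ α → Reach γ (X ∷ α)
    into : ∀ {A β α} → (A , β) ∈ rules → Derives α [] → Reach γ β → Reach γ (inj₁ A ∷ α)

  reach-derives : ∀ {γ α w} → Reach γ α → Derives γ w → Derives α w
  reach-derives stop p = p
  reach-derives (skip n r) p = derives-++⁺ n (reach-derives r p)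
  reach-derives {w = w} (into r n s) p =
    subst (Derives _) (++-identityʳ w) (expand r (reach-derives s p) n)

  module _ (γ : SententialForm) where

    -- `Reach` confined to `forms`, so that finitely many clauses remain. Nothing is lost there,
    -- because `forms` contains the tails of its members and all rule bodies.
    data ReachClause : List SententialForm × SententialForm → Set where
      stop : ReachClause ([] , γ)
      skip : ∀ {X α} → X ∷ α ∈ forms → Derives [ X ] [] → ReachClause ([ α ] , X ∷ α)
      into : ∀ {A β α} → inj₁ A ∷ α ∈ forms → (A , β) ∈ rules → Derives α [] →
             ReachClause ([ β ] , inj₁ A ∷ α)

    Skips Intos : SententialForm → List SententialForm × SententialForm → Set
    Skips δ c = ∃ λ X → ∃ λ α → δ ≡ X ∷ α × Derives [ X ] [] × c ≡ ([ α ] , δ)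
    Intos δ c = ∃ λ A → ∃ λ α → ∃ λ β → δ ≡ inj₁ A ∷ α × (A , β) ∈ rules × Derives α [] ×
                c ≡ ([ β ] , δ)

    skips : ∀ δ → Listing (Skips δ)
    skips []      = none-of λ ()
    skips (X ∷ α) = transport (λ (n , e) → X , α , refl , n , e) (λ { (_ , _ , refl , n , e) → n , e })
      (guarded (null? [ X ]) (pure ([ α ] , X ∷ α)))

    intos : ∀ δ → Listing (Intos δ)
    intos []           = none-of λ ()
    intos (inj₂ a ∷ α) = none-of λ ()
    intos (inj₁ A ∷ α) = transport
      (λ { (n , (A′ , β) , r , refl , e) → A , α , β , refl , r , n , e })
      (λ { (_ , _ , β , refl , r , n , e) → n , (A , β) , r , refl , e })
      (guarded (null? α) (bind (listed rules) λ (A′ , β) →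
        guarded (finite-≟ finiteN A A′) (pure ([ β ] , inj₁ A ∷ α))))

    reachClauses : Listing ReachClause
    reachClauses = transport
      (λ { (inj₁ refl) → stop
         ; (inj₂ (_ , m , inj₁ (_ , _ , refl , n , refl))) → skip m n
         ; (inj₂ (_ , m , inj₂ (_ , _ , _ , refl , r , n , refl))) → into m r n })
      (λ { stop → inj₁ refl
         ; (skip m n) → inj₂ (_ , m , inj₁ (_ , _ , refl , n , refl))
         ; (into m r n) → inj₂ (_ , m , inj₂ (_ , _ , _ , refl , r , n , refl)) })
      (union (pure ([] , γ)) (bind (listed forms) λ δ → union (skips δ) (intos δ)))

    open Horn _≟ᶠ_ reachClauses

    reach-sound : ∀ {α} → Derivable α → Reach γ α
    reach-sound (by stop [])                = stop
    reach-sound (by (skip _ n) (d ∷ []))    = skip n (reach-sound d)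
    reach-sound (by (into _ r n) (d ∷ []))  = into r n (reach-sound d)

    reach-complete : ∀ {α} → α ∈ forms → Reach γ α → Derivable α
    reach-complete m stop         = by stop []
    reach-complete m (skip n r)   = by (skip m n) (reach-complete (forms-tail m) r ∷ [])
    reach-complete m (into r n s) = by (into m r n) (reach-complete (forms-body r) s ∷ [])

    reach? : ∀ k → Dec (Reach γ (form k))
    reach? k = map′ reach-sound (reach-complete (∈-lookup k)) (derivable? (form k))

  -- Erasing and unit steps are hidden in `Reach`: a node first passes from `form k` to `form g`,
  -- and only `form g` is split or read as a letter.
  Lex : K → Σ → Set
  Lex k a = ∃ λ g → ∃ λ α → form g ≡ inj₂ a ∷ α × Derives α [] × Reach (form g) (form k)

  Bin : K → K → K → Set
  Bin k c d = ∃ λ g → ∃ λ X → form c ≡ [ X ] × form g ≡ X ∷ form d × Reach (form g) (form k)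

  lex? : ∀ k a → Dec (Lex k a)
  lex? k a = finite-any? (finite-Fin _) λ g →
    map′ (λ ((α , e , n) , r) → α , e , n , r) (λ (α , e , n , r) → (α , e , n) , r)
         (starts? (form g) ×-dec reach? (form g) k)
    where
    starts? : ∀ γ → Dec (∃ λ α → γ ≡ inj₂ a ∷ α × Derives α [])
    starts? []           = no λ ()
    starts? (inj₁ A ∷ α) = no λ ()
    starts? (inj₂ b ∷ α) = map′ (λ { (refl , n) → α , refl , n }) (λ { (_ , refl , n) → refl , n })
      (finite-≟ finiteΣ b a ×-dec null? α)

  bin? : ∀ k c d → Dec (Bin k c d)
  bin? k c d = finite-any? (finite-Fin _) λ g →
    map′ (λ ((X , e , e′) , r) → X , e , e′ , r) (λ (X , e , e′ , r) → (X , e , e′) , r)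
         (splits? (form c) (form g) ×-dec reach? (form g) k)
    where
    splits? : ∀ γ δ → Dec (∃ λ X → γ ≡ [ X ] × δ ≡ X ∷ form d)
    splits? []          δ = no λ ()
    splits? (X ∷ Y ∷ γ) δ = no λ ()
    splits? (X ∷ [])    δ = map′ (λ e → X , refl , e) (λ { (_ , refl , e) → e }) (δ ≟ᶠ (X ∷ form d))

  S : K
  S = proj₁ (at forms-start)

  open LeftCorner Lex Bin S using (BTree; leaf; node)

  btree-derives : ∀ {k w} → BTree k w → Derives (form k) w
  btree-derives (leaf (g , α , e , n , r)) = reach-derives r (subst (λ γ → Derives γ _) (sym e) (term n))
  btree-derives (node (g , X , e , e′ , r) x y) =
    reach-derives r (subst (λ γ → Derives γ _) (sym e′)
      (derives-++⁺ (subst (λ γ → Derives γ _) e (btree-derives x)) (btree-derives y)))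

  lift : ∀ {k l w} → (∀ {γ} → Reach γ (form k) → Reach γ (form l)) → BTree k w → BTree l w
  lift f (leaf (g , α , e , n , r))        = leaf (g , α , e , n , f r)
  lift f (node (g , X , e , e′ , r) x y) = node (g , X , e , e′ , f r) x y

  -- If one part of the yield is empty, its derivation goes into `Reach` and the tree of the other
  -- part is relabelled by `lift`. Two non-empty parts make a binary node.
  derives-btree : ∀ {α w} → Derives α w → ∀ k → form k ≡ α → w ≢ [] → BTree k w
  derives-btree [] k e n = ⊥-elim (n refl)
  derives-btree (term {a} {α} {[]} p) k e _ =
    leaf (k , α , e , p , stop)
  derives-btree (term {a} {α} {_ ∷ _} p) k e _
    with c , e₁ ← at (forms-head (∈-forms k e)) with d , e₂ ← at (forms-tail (∈-forms k e)) =
      node {C = c} (k , inj₂ a , e₁ , trans e (cong (_ ∷_) (sym e₂)) , stop)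
           (leaf {c} (c , [] , e₁ , [] , stop)) (derives-btree p d e₂ λ ())
  derives-btree (expand {A} {β} {α} {[]} {w} r p q) k e n with d , e₂ ← at (forms-tail (∈-forms k e)) =
    lift {d} (λ s → subst (Reach _) (sym e) (skip (expand r p []) (subst (Reach _) e₂ s)))
         (derives-btree q d e₂ n)
  derives-btree (expand {A} {β} {α} {u@(_ ∷ _)} {[]} r p q) k e n with b , e₁ ← at (forms-body r) =
    subst (BTree k) (sym (++-identityʳ u))
      (lift {b} (λ s → subst (Reach _) (sym e) (into r q (subst (Reach _) e₁ s)))
            (derives-btree p b e₁ λ ()))
  derives-btree (expand {A} {β} {α} {_ ∷ _} {_ ∷ _} r p q) k e n
    with b , e₁ ← at (forms-body r)
    with c , e₂ ← at (forms-head (∈-forms k e))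
    with d , e₃ ← at (forms-tail (∈-forms k e)) =
      node {C = c} (k , inj₁ A , e₂ , trans e (cong (_ ∷_) (sym e₃)) , stop)
        (lift {b} {c} (λ s → subst (Reach _) (sym e₂) (into r [] (subst (Reach _) e₁ s)))
              (derives-btree p b e₁ λ ()))
        (derives-btree q d e₃ λ ())

  btree-generates : ∀ {w} → BTree S w → Generates w
  btree-generates {w} t =
    derives-⇒* (subst (λ γ → Derives γ w) (proj₂ (at forms-start)) (btree-derives t))

  generates-btree : ∀ {w} → Generates w → w ≢ [] → BTree S w
  generates-btree g = derives-btree (⇒*-derives g) S (proj₂ (at forms-start))

-- Finiteness of the constructed grammars

finite-Maybe : ∀ {A} → Finite A → Finite (Maybe A)
finite-Maybe {A} f = finite-↔ (mk↔ₛ′ to from to∘from from∘to) (finite-⊎ f (finite-Fin 1))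
  where
  to : Maybe A → A ⊎ Fin 1
  to (just a) = inj₁ a
  to nothing  = inj₂ 0F
  from : A ⊎ Fin 1 → Maybe A
  from (inj₁ a)  = just a
  from (inj₂ 0F) = nothing
  to∘from : ∀ x → to (from x) ≡ x
  to∘from (inj₁ a)  = refl
  to∘from (inj₂ 0F) = refl
  from∘to : ∀ x → from (to x) ≡ x
  from∘to (just a) = refl
  from∘to nothing  = refl

finite-Sym : ∀ {I} → Finite I → Finite (Sym I)
finite-Sym {I} f = finite-↔ (mk↔ₛ′ to from to∘from from∘to) (finite-⊎ f (finite-⊎ f (finite-Fin 3)))
  where
  to : Sym I → I ⊎ (I ⊎ Fin 3)
  to (nt i)    = inj₁ i
  to (guard i) = inj₂ (inj₁ i)
  to hash      = inj₂ (inj₂ 0F)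
  to dollar    = inj₂ (inj₂ 1F)
  to bot       = inj₂ (inj₂ 2F)
  from : I ⊎ (I ⊎ Fin 3) → Sym I
  from (inj₁ i)         = nt i
  from (inj₂ (inj₁ i))  = guard i
  from (inj₂ (inj₂ 0F)) = hash
  from (inj₂ (inj₂ 1F)) = dollar
  from (inj₂ (inj₂ 2F)) = bot
  to∘from : ∀ x → to (from x) ≡ x
  to∘from (inj₁ i)         = refl
  to∘from (inj₂ (inj₁ i))  = refl
  to∘from (inj₂ (inj₂ 0F)) = refl
  to∘from (inj₂ (inj₂ 1F)) = refl
  to∘from (inj₂ (inj₂ 2F)) = refl
  from∘to : ∀ x → from (to x) ≡ x
  from∘to (nt i)    = refl
  from∘to (guard i) = refl
  from∘to hash      = refl
  from∘to dollar    = refl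
  from∘to bot       = refl

finite-Corner : ∀ {K} → Finite K → Finite (Corner K)
finite-Corner {K} f = finite-↔ (mk↔ₛ′ to from to∘from from∘to) (finite-Maybe (finite-× f f))
  where
  to : Corner K → Maybe (K × K)
  to root         = nothing
  to (corner X A) = just (X , A)
  from : Maybe (K × K) → Corner K
  from nothing        = root
  from (just (X , A)) = corner X A
  to∘from : ∀ x → to (from x) ≡ x
  to∘from nothing  = refl
  to∘from (just _) = refl
  from∘to : ∀ x → from (to x) ≡ x
  from∘to root         = refl
  from∘to (corner _ _) = refl

finite-Spinal : ∀ {Σ I} → Finite Σ → Finite I → Finite (Spinal Σ I)
finite-Spinal {Σ} {I} f g =
  finite-↔ (mk↔ₛ′ to from to∘from from∘to) (finite-⊎ f (finite-⊎ g (finite-× g g)))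
  where
  to : Spinal Σ I → Σ ⊎ (I ⊎ (I × I))
  to (letter b)  = inj₁ b
  to (whole A)   = inj₂ (inj₁ A)
  to (chain Z A) = inj₂ (inj₂ (Z , A))
  from : Σ ⊎ (I ⊎ (I × I)) → Spinal Σ I
  from (inj₁ b)              = letter b
  from (inj₂ (inj₁ A))       = whole A
  from (inj₂ (inj₂ (Z , A))) = chain Z A
  to∘from : ∀ x → to (from x) ≡ x
  to∘from (inj₁ _)        = refl
  to∘from (inj₂ (inj₁ _)) = refl
  to∘from (inj₂ (inj₂ _)) = refl
  from∘to : ∀ x → from (to x) ≡ x
  from∘to (letter _)  = refl
  from∘to (whole _)   = refl
  from∘to (chain _ _) = refl

-- Listing the rules of the transformed grammars

RuleListing : {Σ I : Set} → (Σ → I → List I → Set) → Set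
RuleListing {Σ} {I} R = ∀ a → Listing (λ ((i , α) : I × List I) → R a i α)

opts : ∀ {J : Set} (j : J) {P : Set} → Dec P → Listing (Opt j P)
opts j p? = transport
  (λ { (inj₁ (p , refl)) → none p ; (inj₂ refl) → some })
  (λ { (none p) → inj₁ (p , refl) ; some → inj₂ refl })
  (union (guarded p? (pure [])) (pure [ j ]))

module _ {Σ K : Set} {Lex : K → Σ → Set} {Bin : K → K → K → Set} (S : K) (finiteK : Finite K)
         (lex? : ∀ A a → Dec (Lex A a)) (bin? : ∀ A C D → Dec (Bin A C D)) where
  open LeftCorner Lex Bin S

  private
    _≟_ : DecidableEquality K
    _≟_ = finite-≟ finiteK

    all-K : Listing (_∈ elements finiteK)
    all-K = listed (elements finiteK)

    ∈K : ∀ A → A ∈ elements finiteK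
    ∈K = ∈-elements finiteK

  corner-rules : RuleListing Rule
  corner-rules a = transport
    (λ { (inj₁ (P , l , o , x , refl)) → root l x
       ; (inj₂ (P , l , B , _ , X , _ , C , b , A , _ , o , x , o′ , y , refl)) → step b l x y })
    (λ { (root l x) → inj₁ (_ , l , _ , x , refl)
       ; (step b l x y) → inj₂ (_ , l , _ , ∈K _ , _ , ∈K _ , _ , b , _ , ∈K _ , _ , x , _ , y , refl) })
    (union
      (bind (decidable finiteK λ P → lex? P a) λ P →
       bind (opts (corner P S) (P ≟ S)) λ o →
       pure (root , o))
      (bind (decidable finiteK λ P → lex? P a) λ P →
       bind all-K λ B →
       bind all-K λ X →
       bind (decidable finiteK λ C → bin? B X C) λ C →
       bind all-K λ A →
       bind (opts (corner P C) (P ≟ C)) λ o →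
       bind (opts (corner B A) (B ≟ A)) λ o′ →
       pure (corner X A , o ++ o′)))

module _ {Σ I : Set} {R : Σ → I → List I → Set} (finiteΣ : Finite Σ) (finiteI : Finite I)
         (rules : RuleListing R) where
  open RightSpine R

  private
    _≟_ : DecidableEquality I
    _≟_ = finite-≟ finiteI

  leaves : ∀ a → Listing (λ A → R a A [])
  leaves a = transport (λ { ((_ , []) , r , refl) → r }) (λ r → (_ , []) , r , refl)
    (bind (rules a) λ (A , α) → only-nil A α)
    where
    Nil : I × List I → I → Set
    Nil (A , [])    B = B ≡ A
    Nil (A , _ ∷ _) B = Fin 0
    only-nil : ∀ A α → Listing (Nil (A , α))
    only-nil A []      = pure A
    only-nil A (_ ∷ _) = none-of λ ()

  snocs : ∀ a → Listing (λ ((A , β , Z) : I × List I × I) → R a A (β ∷ʳ Z))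
  snocs a = transport
    (λ { (_ , r , _ , refl , refl) → r })
    (λ r → _ , r , _ , refl , refl)
    (bind (rules a) λ (A , α) → bind (snoc-listing α) λ (β , Z) → pure (A , β , Z))

  spine-rules : RuleListing Rule
  spine-rules a = transport
    (λ { (inj₁ refl) → letter
       ; (inj₂ (inj₁ (_ , r , refl))) → leaf r
       ; (inj₂ (inj₂ (inj₁ (_ , r , b , _ , C , r′ , o , x , refl)))) → spine r x r′
       ; (inj₂ (inj₂ (inj₂ (inj₁ (_ , r , refl))))) → one r
       ; (inj₂ (inj₂ (inj₂ (inj₂ (_ , r , b , _ , _ , r′ , o , x , refl))))) → more r x r′ })
    (λ { letter → inj₁ refl
       ; (leaf r) → inj₂ (inj₁ (_ , r , refl))
       ; (spine r x r′) → inj₂ (inj₂ (inj₁ (_ , r , _ , ∈-elements finiteΣ _ , _ , r′ , _ , x , refl)))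
       ; (one r) → inj₂ (inj₂ (inj₂ (inj₁ (_ , r , refl))))
       ; (more r x r′) →
           inj₂ (inj₂ (inj₂ (inj₂ (_ , r , _ , ∈-elements finiteΣ _ , _ , r′ , _ , x , refl)))) })
    (union (pure (letter a , []))
    (union (bind (leaves a) λ A → pure (whole A , []))
    (union
      (bind (snocs a) λ (A , β , A₁) →
       bind (listed (elements finiteΣ)) λ b →
       bind (leaves b) λ C →
       bind (opts (chain C A₁) (C ≟ A₁)) λ o →
       pure (whole A , map whole β ++ o ++ letter b ∷ []))
    (union
      (bind (snocs a) λ (A , β , Z) → pure (chain Z A , map whole β))
      (bind (snocs a) λ (A , β , A₁) →
       bind (listed (elements finiteΣ)) λ b →
       bind (snocs b) λ (Y , γ , Z) →
       bind (opts (chain Y A₁) (Y ≟ A₁)) λ o →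
       pure (chain Z A , map whole β ++ o ++ letter b ∷ map whole γ))))))

-- Every category occurring in some f a gets a letter of its own.
module Alphabet {Σ BC : Set} (finiteΣ : Finite Σ) (finiteBC : Finite BC) (target : Category BC)
                (f : Σ → List⁺ (Category BC)) where

  categories : List (Category BC)
  categories = List.concatMap (λ a → toList (f a)) (elements finiteΣ)

  Ω : Set
  Ω = Fin (length categories)

  category : Ω → Category BC
  category = lookup categories

  grammar : CategorialGrammar Ω
  grammar = record
    { BC          = BC
    ; finiteBC    = finiteBC
    ; assignments = map (λ ω → ω , category ω) (allFin _)
    ; target      = target
    }

  open CategorialGrammar grammar using (_▷_; language; UniqueAssignment)

  ▷-category : ∀ ω → ω ▷ category ω
  ▷-category ω = ∈-map⁺ (λ ω → ω , category ω) (∈-allFin ω)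

  ▷-unique : ∀ {ω A} → ω ▷ A → category ω ≡ A
  ▷-unique m with _ , _ , refl ← ∈-map⁻ (λ ω → ω , category ω) m = refl

  unique : UniqueAssignment
  unique ω = category ω , ▷-category ω , ▷-unique

  -- Letters come from membership proofs, so no equality test on categories is involved; equal
  -- categories may get different letters.
  encode : (As : List (Category BC)) → (∀ {A} → A ∈ As → A ∈ categories) → List Ω
  encode []       _ = []
  encode (A ∷ As) s = index (s (here refl)) ∷ encode As (λ m → s (there m))

  category-encode : ∀ As (s : ∀ {A} → A ∈ As → A ∈ categories) → map category (encode As s) ≡ As
  category-encode []       s = refl
  category-encode (A ∷ As) s =
    cong₂ _∷_ (sym (lookup-index (s (here refl)))) (category-encode As (λ m → s (there m)))

  ∈-categories : ∀ a {A} → A ∈ toList (f a) → A ∈ categories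
  ∈-categories a m = ∈-concatMap⁺ (λ a → toList (f a)) (lose (∈-elements finiteΣ a) m)

  encode⁺ : (As : List⁺ (Category BC)) → (∀ {A} → A ∈ toList As → A ∈ categories) → List⁺ Ω
  encode⁺ (A ∷ As) s = index (s (here refl)) ∷ encode As (λ m → s (there m))

  h : Σ → List⁺ Ω
  h a = encode⁺ (f a) (∈-categories a)

  category-h : ∀ a → map category (toList (h a)) ≡ toList (f a)
  category-h a = category-encode (toList (f a)) (∈-categories a)

  categories-h : ∀ w → map category (toList (concatMap h w)) ≡
                       List.concatMap (λ a → toList (f a)) (toList w)
  categories-h w =
    trans (cong (map category) (sym (toList->>= h w)))
      (trans (map-concatMap category (λ a → toList (h a)) (toList w))
             (concatMap-cong category-h (toList w)))

  pointwise-category : ∀ ωs → Pointwise _▷_ ωs (map category ωs)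
  pointwise-category []       = []
  pointwise-category (ω ∷ ωs) = ▷-category ω ∷ pointwise-category ωs

  pointwise-unique : ∀ {ωs As} → Pointwise _▷_ ωs As → map category ωs ≡ As
  pointwise-unique []       = refl
  pointwise-unique (x ∷ xs) = cong₂ _∷_ (▷-unique x) (pointwise-unique xs)

  -- Unique assignment leaves a single string of categories for each word over `Ω`.
  language-h : ∀ w → language (concatMap h w) ⇔
                     (List.concatMap (λ a → toList (f a)) (toList w) ⟶* [ target ])
  language-h w = mk⇔
    (λ { (_ , p , r) → subst (_⟶* [ target ]) (trans (sym (pointwise-unique p)) (categories-h w)) r })
    (λ r → _ , pointwise-category _ , subst (_⟶* [ target ]) (sym (categories-h w)) r)

-- Composing the grammar transformations with the coding

theorem1 : ∀ {ℓ} (Σ : Set) → Finite Σ → (L : Language Σ ℓ) → ContextFree L →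
    ∃[ Ω ] Finite Ω ×
    (∃ λ (h : Σ → List⁺ Ω) → ∃ λ (G : CategorialGrammar Ω) →
    let open CategorialGrammar G in
    UniqueAssignment ×
    (∀ (w : List⁺ Σ) → L w ⇔ language (concatMap h w)))
theorem1 Σ finiteΣ L (G , _ , L⇔G) =
  A.Ω , finite-Fin _ , A.h , A.grammar , A.unique ,
  λ w → mk⇔ (λ l → Equivalence.from (A.language-h w) (reduces w (Equivalence.to (L⇔G w) l)))
            (λ m → Equivalence.from (L⇔G w) (generates w (Equivalence.to (A.language-h w) m)))
  where
  module B = Binarise finiteΣ G
  module C = LeftCorner B.Lex B.Bin B.S
  module D = RightSpine C.Rule

  finiteK : Finite B.K
  finiteK = finite-Fin _

  finiteC : Finite (Corner B.K)
  finiteC = finite-Corner finiteK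

  finiteI : Finite (Spinal Σ (Corner B.K))
  finiteI = finite-Spinal finiteΣ finiteC

  listing : RuleListing D.Rule
  listing = spine-rules finiteΣ finiteC (corner-rules B.S finiteK B.lex? B.bin?)

  open Simulation (λ a → list (listing a)) D.rank
                  (λ {a} m → D.ranked (list-sound (listing a) m)) (whole root)
  open Coding (Sym (Spinal Σ (Corner B.K)))

  -- This is `codes (ops a)`, with the first category split off to exhibit it as non-empty.
  f : Σ → List⁺ Cat
  f a = pushCat (init ++ [ bot ]) ∷ (P ++ codes (rest a))

  module A = Alphabet finiteΣ (finite-Maybe (finite-Sym finiteI)) (target bot) f

  f-codes : ∀ w → List.concatMap (λ a → toList (f a)) w ≡ codes (List.concatMap ops w)
  f-codes []      = refl
  f-codes (a ∷ w) = trans (cong (codes (ops a) ++_) (f-codes w))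
                          (sym (concatMap-++ code (ops a) (List.concatMap ops w)))

  reduces : ∀ w → ContextFreeGrammar.Generates G (toList w) →
            List.concatMap (λ a → toList (f a)) (toList w) ⟶* [ target bot ]
  reduces (a ∷ w) g =
    subst (_⟶* [ target bot ]) (sym (f-codes (a ∷ w)))
      -- From the inside out: binary tree, left-corner tree, right-spine tree, leftmost derivation,
      -- run, reduction.
      (complete init bot (gen⇒run₁
        (gen-map (λ {b} → list-complete (listing b))
          (Trees.tree⇒gen₁ D.Rule (D.complete _ ≤-refl
            (C.complete (B.generates-btree g λ ())))))))

  generates : ∀ w → List.concatMap (λ a → toList (f a)) (toList w) ⟶* [ target bot ] →
              ContextFreeGrammar.Generates G (toList w)
  generates (a ∷ w) r =
    B.btree-generates (C.sound (D.sound (Trees.gen⇒tree D.Rule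
      (gen-map (λ {b} → list-sound (listing b))
        (run⇒gen₁ a w (sound (List.concatMap ops (a ∷ w)) bot
          (subst (_⟶* [ target bot ]) (f-codes (a ∷ w)) r)))))))
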